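{- For every graph $G$ and every positive integer $k$, there exists a $(\leq 3\cdot 4^{\lceil |E(G)|/k\rceil})$-subdivision $S$ of $G$ with $\phi(S)\le 2+12k$.
   Context: An anagram is a word of the form $WP$ where $W$ is a non-empty word and $P$ is a permutation of $W$. A vertex colouring of a graph is anagram-free if the sequence of colours along every path of the graph is not an anagram. $\phi(G)$ is the minimum number of colours in an anagram-free colouring of $G$. A subdivision of $G$ is obtained by replacing each edge $uv$ by a path with endpoints $u,v$; internal vertices are division vertices. A $(\le m)$-subdivision is a subdivision in which every edge receives at most $m$ division vertices. -}

module Defs where

open import Data.Nat using (ℕ; zero; suc; _+_; _*_; _∸_; _≤_; _<_; NonZero)
open import Data.Nat.DivMod using (_/_)
open import Data.Fin using (Fin; toℕ)
open import Data.List using (List; []; _∷_; _++_; length; map; lookup)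
open import Data.List.Relation.Unary.All using (All)
open import Data.List.Relation.Unary.Linked using (Linked)
open import Data.List.Relation.Unary.Unique.Propositional using (Unique)
open import Data.List.Relation.Binary.Permutation.Propositional using (_↭_)
open import Data.Product using (Σ; ∃; ∃-syntax; _×_; _,_; proj₁; proj₂)
open import Data.Sum using (_⊎_; inj₁; inj₂)
open import Relation.Nullary using (¬_)
open import Relation.Binary.PropositionalEquality using (_≡_; _≢_)

record Graph : Set₁ where
  field
    V   : Set
    Adj : V → V → Set

-- Finite simple graphs: vertices Fin n, edges a duplicate-free list of
-- pairs (u , v) with u < v (so no loops, no multi-edges, each edge
-- recorded once).

record SimpleGraph : Set where
  field
    n       : ℕ
    edges   : List (Fin n × Fin n)
    ordered : All (λ e → toℕ (proj₁ e) < toℕ (proj₂ e)) edges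
    nodup   : Unique edges

  numEdges : ℕ
  numEdges = length edges

  Edge : Set
  Edge = Fin numEdges

  src tgt : Edge → Fin n
  src i = proj₁ (lookup edges i)
  tgt i = proj₂ (lookup edges i)

open SimpleGraph public

-- Subdivision of G where edge i = uv receives  d i  division vertices,
-- forming the path  u - (i,0) - (i,1) - ... - (i, d i - 1) - v.

module _ (G : SimpleGraph) (d : Edge G → ℕ) where

  SubdivV : Set
  SubdivV = Fin (n G) ⊎ Σ (Edge G) (λ i → Fin (d i))

  data SubdivArc : SubdivV → SubdivV → Set where
    arc-direct : (i : Edge G) → d i ≡ 0 →
                 SubdivArc (inj₁ (src G i)) (inj₁ (tgt G i))
    arc-first  : (i : Edge G) (j : Fin (d i)) → toℕ j ≡ 0 →
                 SubdivArc (inj₁ (src G i)) (inj₂ (i , j))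
    arc-middle : (i : Edge G) (j j′ : Fin (d i)) → suc (toℕ j) ≡ toℕ j′ →
                 SubdivArc (inj₂ (i , j)) (inj₂ (i , j′))
    arc-last   : (i : Edge G) (j : Fin (d i)) → suc (toℕ j) ≡ d i →
                 SubdivArc (inj₂ (i , j)) (inj₁ (tgt G i))

  subdivision : Graph
  subdivision = record
    { V   = SubdivV
    ; Adj = λ x y → SubdivArc x y ⊎ SubdivArc y x
    }

IsPath : (H : Graph) → List (Graph.V H) → Set
IsPath H vs = Unique vs × Linked (Graph.Adj H) vs

IsAnagram : {A : Set} → List A → Set
IsAnagram {A} xs = ∃[ W ] ∃[ P ] (W ≢ [] × P ↭ W × xs ≡ W ++ P)

AnagramFree : (H : Graph) {c : ℕ} → (Graph.V H → Fin c) → Set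
AnagramFree H col = ∀ (vs : List (Graph.V H)) → IsPath H vs → ¬ IsAnagram (map col vs)

φ≤ : Graph → ℕ → Set
φ≤ H c = Σ (Graph.V H → Fin c) (λ col → AnagramFree H col)

⌈_/_⌉ : (m k : ℕ) → .{{NonZero k}} → ℕ
⌈ m / k ⌉ = (m + k ∸ 1) / k

-- An edge of rank r in palette c is subdivided by a word in which a letter of a fixed
-- abelian-square-free word alternates with marker colours; the word has five blocks, and
-- the markers of block j are 2 ^ r copies of the colour (c , j).  Suppose a path spells an
-- anagram.  Its two halves have four ends, so some j names no block that contains an end.
-- Then every j-th block lies completely in one half or misses the path.  Within a palette
-- the ranks are distinct, so equality of the two marker counts is an equality between
-- sums of powers of two over disjoint sets, which must be empty: the path avoids all j-th
-- blocks.  Hence it stays in a subdivided star around one original vertex, meets at most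
-- one original vertex, by balance none, and runs inside one edge.  There the unmarked
-- letters form an abelian square.
--
-- The abelian-square-free word is obtained by iterating a morphism.  A weight modulo 317 that
-- vanishes on all images takes values without nontrivial three-term progressions on the
-- proper prefixes of images.  So the three cuts of an abelian square sit at the same place
-- of an image, and can be moved to image boundaries; the incidence matrix being
-- invertible, this gives an abelian square in the preimage.
module Submission where

open import Defs
open import Data.Nat using (ℕ; zero; suc; _+_; _*_; _∸_; _^_; _/_; _%_; _≤_; _<_; _≤?_; _<?_; z≤n; s≤s; NonZero; ⌈_/2⌉)
open import Data.Nat.Properties
open import Algebra.Properties.CommutativeSemigroup +-commutativeSemigroup using (interchange)
open import Data.Nat.Divisibility using (_∣_; _∣?_; divides; _∣0; ∣m∣n⇒∣m+n)
open import Data.Nat.DivMod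
  using (_mod_; m≡m%n+[m/n]*n; m%n<n; m<n⇒m%n≡m; [m+kn]%n≡m%n; m*n/n≡m; /-monoˡ-≤; m<n*o⇒m/o<n; m/n≡1+[m∸n]/n)
open import Data.Nat.ListAction using (sum)
open import Data.Nat.ListAction.Properties using (sum-++; sum-↭)
open import Data.Nat.Tactic.RingSolver using (solve-∀)
open import Data.Bool using (if_then_else_)
open import Data.Empty using (⊥)
open import Data.Fin using (Fin; toℕ; fromℕ<; combine; remQuot; splitAt; _↑ˡ_; _↑ʳ_)
open import Data.Fin.Patterns
import Data.Fin.Properties as Fin
open import Data.List as List using (List; []; _∷_; _++_; length; map; concatMap; take)
import Data.List.Properties as List
open import Data.List.Properties using (map-++; map-∘)
open import Data.List.Membership.DecPropositional _≟_ using () renaming (_∈?_ to _∈ℕ?_)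
open import Data.List.Membership.Propositional using (_∈_; _∉_)
open import Data.List.Membership.Propositional.Properties using (∈-map⁺; ∈-++⁺ˡ; ∈-++⁺ʳ; ∈-++⁻)
open import Data.List.Relation.Binary.Permutation.Propositional.Properties using (map⁺)
open import Data.List.Relation.Unary.All as All using (All; []; _∷_)
open import Data.List.Relation.Unary.All.Properties using (++⁻ˡ; ++⁻ʳ)
open import Data.List.Relation.Unary.AllPairs using ([]; _∷_)
open import Data.List.Relation.Unary.Any as Any using (here; there)
open import Data.List.Relation.Unary.Any.Properties using (lookup-index)
open import Data.List.Relation.Unary.Linked using (Linked; []; [-]; _∷_)
open import Data.List.Relation.Unary.Unique.Propositional using (Unique)
open import Data.Product using (Σ; ∃; ∃₂; ∃-syntax; _×_; _,_; proj₁; proj₂; map₁)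
import Data.Product.Properties as Product
open import Data.Sum as Sum using (_⊎_; inj₁; inj₂; [_,_]′)
open import Data.Vec using (lookup; []; _∷_)
open import Function using (_∘_; const)
open import Relation.Binary.PropositionalEquality
open import Relation.Nullary using (Dec; yes; no; ¬_; ¬?; contradiction)
open import Relation.Nullary.Decidable
  using (from-yes; decidable-stable; dec-true; dec-false; does; _⊎-dec_; _→-dec_; _×-dec_)

-- Additive weights of lists and finite sums.

wt : {A : Set} → (A → ℕ) → List A → ℕ
wt f = sum ∘ map f

wt-++ : {A : Set} (f : A → ℕ) (xs ys : List A) → wt f (xs ++ ys) ≡ wt f xs + wt f ys
wt-++ f xs ys = trans (cong sum (map-++ f xs ys)) (sum-++ (map f xs) (map f ys))

wt-1 : {A : Set} (xs : List A) → wt (const 1) xs ≡ length xs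
wt-1 []       = refl
wt-1 (x ∷ xs) = cong suc (wt-1 xs)

wt-cong : {A : Set} {f g : A → ℕ} → (∀ x → f x ≡ g x) → ∀ xs → wt f xs ≡ wt g xs
wt-cong eq []       = refl
wt-cong eq (x ∷ xs) = cong₂ _+_ (eq x) (wt-cong eq xs)

wt-+ : {A : Set} (f g : A → ℕ) (xs : List A) → wt (λ x → f x + g x) xs ≡ wt f xs + wt g xs
wt-+ f g []       = refl
wt-+ f g (x ∷ xs) = trans (cong (f x + g x +_) (wt-+ f g xs)) (interchange (f x) (g x) (wt f xs) (wt g xs))

wt-* : {A : Set} (c : ℕ) (f : A → ℕ) (xs : List A) → wt (λ x → c * f x) xs ≡ c * wt f xs
wt-* c f []       = sym (*-zeroʳ c)
wt-* c f (x ∷ xs) = trans (cong (c * f x +_) (wt-* c f xs)) (sym (*-distribˡ-+ c (f x) (wt f xs)))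

wt-concatMap : {A B : Set} (f : B → ℕ) (h : A → List B) (xs : List A) →
  wt f (concatMap h xs) ≡ wt (wt f ∘ h) xs
wt-concatMap f h []       = refl
wt-concatMap f h (x ∷ xs) = trans (wt-++ f (h x) (concatMap h xs)) (cong (wt f (h x) +_) (wt-concatMap f h xs))

∑ : ℕ → (ℕ → ℕ) → ℕ
∑ zero    g = 0
∑ (suc n) g = ∑ n g + g n

∑-cong : ∀ n {g h : ℕ → ℕ} → (∀ i → i < n → g i ≡ h i) → ∑ n g ≡ ∑ n h
∑-cong zero    eq = refl
∑-cong (suc n) eq = cong₂ _+_ (∑-cong n (λ i i<n → eq i (m<n⇒m<1+n i<n))) (eq n ≤-refl)

∑-0 : ∀ n {g : ℕ → ℕ} → (∀ i → i < n → g i ≡ 0) → ∑ n g ≡ 0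
∑-0 zero    eq = refl
∑-0 (suc n) eq = cong₂ _+_ (∑-0 n (λ i i<n → eq i (m<n⇒m<1+n i<n))) (eq n ≤-refl)

∑-+ : ∀ n (g h : ℕ → ℕ) → ∑ n (λ i → g i + h i) ≡ ∑ n g + ∑ n h
∑-+ zero    g h = refl
∑-+ (suc n) g h = trans (cong (_+ (g n + h n)) (∑-+ n g h)) (interchange (∑ n g) (∑ n h) (g n) (h n))

*-∑ : ∀ c n (g : ℕ → ℕ) → ∑ n (λ i → c * g i) ≡ c * ∑ n g
*-∑ c zero    g = sym (*-zeroʳ c)
*-∑ c (suc n) g = trans (cong (_+ c * g n) (*-∑ c n g)) (sym (*-distribˡ-+ c (∑ n g) (g n)))

∑-const : ∀ c n → ∑ n (const c) ≡ n * c
∑-const c zero    = refl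
∑-const c (suc n) = trans (cong (_+ c) (∑-const c n)) (+-comm (n * c) c)

wt-∑ : {A : Set} (n : ℕ) (g : ℕ → A → ℕ) (xs : List A) →
  wt (λ x → ∑ n (λ i → g i x)) xs ≡ ∑ n (λ i → wt (g i) xs)
wt-∑ n g []       = sym (∑-0 n (λ _ _ → refl))
wt-∑ n g (x ∷ xs) = trans (cong (∑ n (λ i → g i x) +_) (wt-∑ n g xs)) (sym (∑-+ n (λ i → g i x) _))

ι : ℕ → ℕ → ℕ
ι i j = if does (i ≟ j) then 1 else 0

ι-≡ : ∀ {i j} → i ≡ j → ι i j ≡ 1
ι-≡ {i} {j} i≡j = cong (if_then 1 else 0) (dec-true (i ≟ j) i≡j)

ι-≢ : ∀ {i j} → i ≢ j → ι i j ≡ 0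
ι-≢ {i} {j} i≢j = cong (if_then 1 else 0) (dec-false (i ≟ j) i≢j)

∑-ι : ∀ n {j} (g : ℕ → ℕ) → j < n → ∑ n (λ i → ι i j * g i) ≡ g j
∑-ι (suc n) {j} g j<1+n with n ≟ j
... | yes refl = cong₂ _+_ (∑-0 n (λ i i<n → cong (_* g i) (ι-≢ (<⇒≢ i<n))))
  (trans (cong (_* g n) (ι-≡ {n} refl)) (*-identityˡ (g n)))
... | no n≢j   = trans (cong (λ c → ∑ n (λ i → ι i j * g i) + c * g n) (ι-≢ n≢j))
  (trans (+-identityʳ _) (∑-ι n g (≤∧≢⇒< (m<1+n⇒m≤n j<1+n) (≢-sym n≢j))))

-- Seven letters, a morphism on them, and the cuts of its images.

Letter : Set
Letter = Fin 7

Word : Set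
Word = List Letter

δ : ℕ → Letter → ℕ
δ i x = ι i (toℕ x)

-- Expansion in the seven letter counts, which reduces an equation for all weights to the weights
-- `δ i`. The `mod 7` only turns a summation index into a letter.
wt-δ : (f : Letter → ℕ) (w : Word) → wt f w ≡ ∑ 7 (λ i → f (i mod 7) * wt (δ i) w)
wt-δ f w = trans (wt-cong expand w) (trans (wt-∑ 7 (λ i x → f (i mod 7) * δ i x) w)
  (∑-cong 7 (λ i _ → wt-* (f (i mod 7)) (δ i) w)))
  where
  expand : ∀ x → f x ≡ ∑ 7 (λ i → f (i mod 7) * δ i x)
  expand x = sym (trans (∑-cong 7 (λ i _ → *-comm (f (i mod 7)) (δ i x)))
    (trans (∑-ι 7 (λ i → f (i mod 7)) (Fin.toℕ<n x)) (cong f (toℕ-mod x))))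
    where
    toℕ-mod : ∀ (x : Letter) → toℕ x mod 7 ≡ x
    toℕ-mod = from-yes (Fin.all? λ x → toℕ x mod 7 Fin.≟ x)

-- The morphism, the weight  hash  and the modulus 317 were found by computer search.
image : Letter → Word
image 0F = 2F ∷ 5F ∷ 6F ∷ 3F ∷ 0F ∷ 6F ∷ 5F ∷ 6F ∷ 4F ∷ 0F ∷ 6F ∷ 0F ∷ []
image 1F = 2F ∷ 1F ∷ 0F ∷ 1F ∷ 4F ∷ 0F ∷ 6F ∷ 0F ∷ []
image 2F = 2F ∷ 5F ∷ 6F ∷ 3F ∷ 4F ∷ 3F ∷ 2F ∷ 3F ∷ 4F ∷ 0F ∷ 6F ∷ 0F ∷ []
image 3F = 2F ∷ 5F ∷ 6F ∷ 1F ∷ 5F ∷ 1F ∷ 3F ∷ []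
image 4F = 2F ∷ 5F ∷ 6F ∷ 1F ∷ 4F ∷ []
image 5F = 2F ∷ 1F ∷ 0F ∷ 5F ∷ 0F ∷ []
image 6F = 2F ∷ 5F ∷ 6F ∷ 1F ∷ 6F ∷ 2F ∷ 6F ∷ 0F ∷ []

hash : Letter → ℕ
hash = lookup (87 ∷ 65 ∷ 69 ∷ 94 ∷ 168 ∷ 9 ∷ 6 ∷ [])

-- A cut (p , s) sits p after an image boundary, or equally s before the next one.  Images
-- share prefixes and suffixes; each position is recorded in  cuts  with its unambiguous
-- side only, the other component being [].
Cut : Set
Cut = Word × Word

-- The right part is never empty: the right end of an image counts as the left end of the next one.
splits : Word → List Cut
splits []      = []
splits (x ∷ w) = ([] , x ∷ w) ∷ map (map₁ (x ∷_)) (splits w)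

∈-splits : ∀ p z s → (p , z ∷ s) ∈ splits (p ++ z ∷ s)
∈-splits []      z s = here refl
∈-splits (x ∷ p) z s = there (∈-map⁺ (map₁ (x ∷_)) (∈-splits p z s))

_≟c_ : (c c′ : Cut) → Dec (c ≡ c′)
_≟c_ = Product.≡-dec (List.≡-dec Fin._≟_) (List.≡-dec Fin._≟_)

cuts : List Cut
cuts =
  map (λ p → p , [])
    ( []
    ∷ (2F ∷ [])
    ∷ (2F ∷ 1F ∷ [])
    ∷ (2F ∷ 1F ∷ 0F ∷ [])
    ∷ (2F ∷ 5F ∷ [])
    ∷ (2F ∷ 5F ∷ 6F ∷ [])
    ∷ (2F ∷ 5F ∷ 6F ∷ 1F ∷ [])
    ∷ (2F ∷ 5F ∷ 6F ∷ 1F ∷ 5F ∷ [])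
    ∷ (2F ∷ 5F ∷ 6F ∷ 1F ∷ 5F ∷ 1F ∷ [])
    ∷ (2F ∷ 5F ∷ 6F ∷ 1F ∷ 6F ∷ [])
    ∷ (2F ∷ 5F ∷ 6F ∷ 3F ∷ [])
    ∷ (2F ∷ 5F ∷ 6F ∷ 3F ∷ 0F ∷ [])
    ∷ (2F ∷ 5F ∷ 6F ∷ 3F ∷ 0F ∷ 6F ∷ [])
    ∷ (2F ∷ 5F ∷ 6F ∷ 3F ∷ 0F ∷ 6F ∷ 5F ∷ [])
    ∷ (2F ∷ 5F ∷ 6F ∷ 3F ∷ 4F ∷ [])
    ∷ (2F ∷ 5F ∷ 6F ∷ 3F ∷ 4F ∷ 3F ∷ [])
    ∷ (2F ∷ 5F ∷ 6F ∷ 3F ∷ 4F ∷ 3F ∷ 2F ∷ [])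
    ∷ []) ++
  map (λ s → [] , s)
    ( (0F ∷ [])
    ∷ (6F ∷ 0F ∷ [])
    ∷ (0F ∷ 6F ∷ 0F ∷ [])
    ∷ (4F ∷ 0F ∷ 6F ∷ 0F ∷ [])
    ∷ [])

Covered : Cut → Set
Covered (p , s) = (p , []) ∈ cuts ⊎ ([] , s) ∈ cuts

splits-covered : ∀ a → All Covered (splits (image a))
splits-covered = from-yes (Fin.all? λ a → All.all? covered? (splits (image a)))
  where
  covered? : ∀ c → Dec (Covered c)
  covered? (p , s) = Any.any? ((p , []) ≟c_) cuts ⊎-dec Any.any? (([] , s) ≟c_) cuts

-- The hash of a cut is  wt hash p − wt hash s;  all subtracted terms are moved across.
AP : Cut → Cut → Cut → Set
AP (p₁ , s₁) (p₂ , s₂) (p₃ , s₃) =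
  (wt hash p₁ + wt hash p₃ + 2 * wt hash s₂) % 317 ≡ (wt hash s₁ + wt hash s₃ + 2 * wt hash p₂) % 317

AP? : ∀ c₁ c₂ c₃ → Dec (AP c₁ c₂ c₃)
AP? (p₁ , s₁) (p₂ , s₂) (p₃ , s₃) = _ ≟ _

-- A finite check over all triples of the 21 cuts. Recording the prefix or the suffix side gives the
-- same hash modulo 317, because whole images have hash zero there.
cuts-AP-free : All (λ c₁ → All (λ c₂ → All (λ c₃ → AP c₁ c₂ c₃ → c₁ ≡ c₂ × c₃ ≡ c₂) cuts) cuts) cuts
cuts-AP-free = from-yes (All.all? (λ c₁ → All.all? (λ c₂ → All.all? (λ c₃ →
  AP? c₁ c₂ c₃ →-dec (c₁ ≟c c₂ ×-dec c₃ ≟c c₂)) cuts) cuts) cuts)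

abstract

  []∈cuts : ([] , []) ∈ cuts
  []∈cuts = here refl

  image-split : ∀ a p z s → p ++ z ∷ s ≡ image a → (p , []) ∈ cuts ⊎ ([] , z ∷ s) ∈ cuts
  image-split a p z s eq = All.lookup (splits-covered a)
    (subst (λ w → (p , z ∷ s) ∈ splits w) eq (∈-splits p z s))

  aligned : ∀ {c₁ c₂ c₃} → c₁ ∈ cuts → c₂ ∈ cuts → c₃ ∈ cuts → AP c₁ c₂ c₃ → c₁ ≡ c₂ × c₃ ≡ c₂
  aligned c₁∈ c₂∈ c₃∈ = All.lookup (All.lookup (All.lookup cuts-AP-free c₁∈) c₂∈) c₃∈

-- 317 times the inverse of the incidence matrix of the morphism, with 157 added to every
-- entry to make it a natural number.
dual : Letter → Letter → ℕ
dual 0F = lookup (190 ∷ 127 ∷ 52 ∷ 138 ∷ 177 ∷ 226 ∷ 203 ∷ [])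
dual 1F = lookup (189 ∷ 272 ∷ 84 ∷ 177 ∷ 186 ∷ 51 ∷ 192 ∷ [])
dual 2F = lookup (155 ∷ 130 ∷ 221 ∷ 235 ∷ 175 ∷ 124 ∷ 135 ∷ [])
dual 3F = lookup (130 ∷ 268 ∷ 70 ∷ 259 ∷ 83 ∷ 187 ∷ 177 ∷ [])
dual 4F = lookup (96 ∷ 126 ∷ 207 ∷ 0 ∷ 389 ∷ 260 ∷ 120 ∷ [])
dual 5F = lookup (232 ∷ 60 ∷ 293 ∷ 85 ∷ 116 ∷ 285 ∷ 31 ∷ [])
dual 6F = lookup (133 ∷ 150 ∷ 291 ∷ 142 ∷ 56 ∷ 78 ∷ 210 ∷ [])

-- Inverse matrix times incidence matrix is the identity, scaled by 317; the offset contributes 157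
-- for each letter of the image.
wt-dual-image : ∀ a x → wt (dual a) (image x) ≡ 317 * δ (toℕ a) x + 157 * length (image x)
wt-dual-image = from-yes (Fin.all? λ a → Fin.all? λ x →
  wt (dual a) (image x) ≟ 317 * δ (toℕ a) x + 157 * length (image x))

317∣wt-hash-image : ∀ x → 317 ∣ wt hash (image x)
317∣wt-hash-image = from-yes (Fin.all? λ x → 317 ∣? wt hash (image x))

-- Preservation of abelian-square-freeness by the morphism.

morphism : Word → Word
morphism = concatMap image

-- For prefixes of one word: the factors from `X` to `Y` and from `Y` to `Z` have the same letter
-- counts, stated without subtraction.
Balanced : Word → Word → Word → Set
Balanced X Y Z = ∀ f → wt f X + wt f Z ≡ wt f Y + wt f Y

-- The weights `dual a` recover the letter counts of the preimages. Their offset adds 157 times the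
-- image length, which is balanced by the weight `const 1` and so cancels.
balanced-morphism⁻¹ : ∀ {X Y Z} → Balanced (morphism X) (morphism Y) (morphism Z) → Balanced X Y Z
balanced-morphism⁻¹ {X} {Y} {Z} bal f = begin
  wt f X + wt f Z
    ≡⟨ cong₂ _+_ (wt-δ f X) (wt-δ f Z) ⟩
  ∑ 7 (term X) + ∑ 7 (term Z)
    ≡⟨ ∑-+ 7 (term X) (term Z) ⟨
  ∑ 7 (λ i → term X i + term Z i)
    ≡⟨ ∑-cong 7 (λ i i<7 → terms (f (i mod 7)) (wt (δ i) X) (wt (δ i) Y) (wt (δ i) Z) (letters i<7)) ⟩
  ∑ 7 (λ i → term Y i + term Y i)
    ≡⟨ ∑-+ 7 (term Y) (term Y) ⟩
  ∑ 7 (term Y) + ∑ 7 (term Y)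
    ≡⟨ cong₂ _+_ (wt-δ f Y) (wt-δ f Y) ⟨
  wt f Y + wt f Y ∎
  where
  open ≡-Reasoning
  term : Word → ℕ → ℕ
  term w i = f (i mod 7) * wt (δ i) w
  terms : ∀ c x y z → x + z ≡ y + y → c * x + c * z ≡ c * y + c * y
  terms c x y z eq = trans (sym (*-distribˡ-+ c x z)) (trans (cong (c *_) eq) (*-distribˡ-+ c y y))
  ℓ : Word → ℕ
  ℓ w = wt (length ∘ image) w
  wt-dual : ∀ a w → wt (dual a) (morphism w) ≡ 317 * wt (δ (toℕ a)) w + 157 * ℓ w
  wt-dual a w = trans (wt-concatMap (dual a) image w) (trans (wt-cong (wt-dual-image a) w)
    (trans (wt-+ (λ x → 317 * δ (toℕ a) x) (λ x → 157 * length (image x)) w)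
      (cong₂ _+_ (wt-* 317 (δ (toℕ a)) w) (wt-* 157 (length ∘ image) w))))
  lengths : ℓ X + ℓ Z ≡ ℓ Y + ℓ Y
  lengths = trans (sym (cong₂ _+_ (wt-ℓ X) (wt-ℓ Z))) (trans (bal (const 1)) (cong₂ _+_ (wt-ℓ Y) (wt-ℓ Y)))
    where
    wt-ℓ : ∀ w → wt (const 1) (morphism w) ≡ ℓ w
    wt-ℓ w = trans (wt-concatMap (const 1) image w) (wt-cong (wt-1 ∘ image) w)
  cancel : ∀ d e .{{_ : NonZero d}} {x y z p q r} → p + r ≡ q + q →
    (d * x + e * p) + (d * z + e * r) ≡ (d * y + e * q) + (d * y + e * q) → x + z ≡ y + y
  cancel d e {x} {y} {z} {p} {q} {r} pr eq = *-cancelˡ-≡ _ _ d (+-cancelʳ-≡ (e * (q + q)) _ _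
    (trans (cong (λ t → d * (x + z) + e * t) (sym pr))
      (trans (rearrange d e x z p r) (trans eq (sym (rearrange d e y y q q))))))
    where
    rearrange : ∀ d e x z p r → d * (x + z) + e * (p + r) ≡ (d * x + e * p) + (d * z + e * r)
    rearrange = solve-∀
  letter : ∀ a → wt (δ (toℕ a)) X + wt (δ (toℕ a)) Z ≡ wt (δ (toℕ a)) Y + wt (δ (toℕ a)) Y
  letter a = cancel 317 157 {wt (δ (toℕ a)) X} {wt (δ (toℕ a)) Y} {wt (δ (toℕ a)) Z} {ℓ X} {ℓ Y} {ℓ Z} lengths
    (trans (sym (cong₂ _+_ (wt-dual a X) (wt-dual a Z))) (trans (bal (dual a)) (cong₂ _+_ (wt-dual a Y) (wt-dual a Y))))
  letters : ∀ {i} → i < 7 → wt (δ i) X + wt (δ i) Z ≡ wt (δ i) Y + wt (δ i) Y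
  letters i<7 = subst (λ i → wt (δ i) X + wt (δ i) Z ≡ wt (δ i) Y + wt (δ i) Y)
    (Fin.toℕ-fromℕ< i<7) (letter (fromℕ< i<7))

-- With a prefix side `p`, the word `X` weighs as much as the image of `before` followed by `p`;
-- with a suffix side `s`, `X` followed by `s` weighs as much as that image. One equation serves
-- both cases, since the other component is empty.
record CutAt (w X : Word) : Set where
  constructor cutAt
  field
    {before after} : Word
    split : before ++ after ≡ w
    {cut}   : Cut
    cut∈    : cut ∈ cuts
    wt-cut  : ∀ f → wt f X + wt f (proj₂ cut) ≡ wt f (morphism before) + wt f (proj₁ cut)

++-compare : {A : Set} (xs : List A) {ys : List A} (us : List A) {vs : List A} → us ++ vs ≡ xs ++ ys →
  (∃₂ λ z zs → us ++ z ∷ zs ≡ xs) ⊎ (∃ λ us′ → us ≡ xs ++ us′ × us′ ++ vs ≡ ys)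
++-compare []       us       eq = inj₂ (us , refl , eq)
++-compare (x ∷ xs) []       eq = inj₁ (x , xs , refl)
++-compare (x ∷ xs) (u ∷ us) eq with List.∷-injective eq
... | refl , eq′ with ++-compare xs us eq′
...   | inj₁ (z , zs , refl)   = inj₁ (z , zs , refl)
...   | inj₂ (us′ , refl , eq″) = inj₂ (us′ , refl , eq″)

cutAt-prefix : ∀ w X {X′} → X ++ X′ ≡ morphism w → CutAt w X
cutAt-prefix []      []  eq = cutAt {before = []} refl []∈cuts (λ f → refl)
cutAt-prefix (a ∷ w) X   eq with ++-compare (image a) X eq
... | inj₂ (X″ , refl , eq′) = let cutAt {before} split cut∈ wt-cut = cutAt-prefix w X″ eq′ in
  cutAt {before = a ∷ before} (cong (a ∷_) split) cut∈ λ f → begin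
    wt f (image a ++ X″) + _          ≡⟨ cong (_+ _) (wt-++ f (image a) X″) ⟩
    wt f (image a) + wt f X″ + _      ≡⟨ +-assoc (wt f (image a)) _ _ ⟩
    wt f (image a) + (wt f X″ + _)    ≡⟨ cong (wt f (image a) +_) (wt-cut f) ⟩
    wt f (image a) + (wt f (morphism before) + _) ≡⟨ +-assoc (wt f (image a)) _ _ ⟨
    wt f (image a) + wt f (morphism before) + _   ≡⟨ cong (_+ _) (wt-++ f (image a) (morphism before)) ⟨
    wt f (morphism (a ∷ before)) + _  ∎
  where open ≡-Reasoning
... | inj₁ (z , s , eq′) with image-split a X z s eq′
...   | inj₁ p∈ = cutAt {before = []} refl p∈ (λ f → +-comm (wt f X) 0)
-- With a suffix side, the image that is being cut counts as lying before the cut.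
...   | inj₂ s∈ = cutAt {before = a ∷ []} refl s∈ λ f →
  trans (sym (wt-++ f X (z ∷ s))) (trans (cong (wt f) (trans eq′ (sym (List.++-identityʳ (image a))))) (sym (+-identityʳ _)))

-- The prefixes ending at the three cuts of an abelian square.  Their order need not be
-- imposed: by  f = const 1  their lengths are in arithmetic progression, with Y in the middle.
AbelianSquareFree : Word → Set
AbelianSquareFree w = ∀ X Y Z {X′ Y′ Z′} → X ++ X′ ≡ w → Y ++ Y′ ≡ w → Z ++ Z′ ≡ w →
  Balanced X Y Z → ∀ f → wt f X ≡ wt f Y

317∣wt-hash-morphism : ∀ w → 317 ∣ wt hash (morphism w)
317∣wt-hash-morphism []      = 317 ∣0
317∣wt-hash-morphism (a ∷ w) = subst (317 ∣_) (sym (wt-++ hash (image a) (morphism w)))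
  (∣m∣n⇒∣m+n (317∣wt-hash-image a) (317∣wt-hash-morphism w))

-- Modulo `n` the boundary terms `h₁`, `h₂`, `h₃` vanish, so each `x` becomes the difference of its
-- `π` and `σ`, and the balance becomes the condition `AP`.
balanced-mod : ∀ {n} .{{_ : NonZero n}} {x₁ x₂ x₃ h₁ h₂ h₃} σ₁ σ₂ σ₃ π₁ π₂ π₃ → n ∣ h₁ → n ∣ h₂ → n ∣ h₃ →
  x₁ + x₃ ≡ x₂ + x₂ → x₁ + σ₁ ≡ h₁ + π₁ → x₂ + σ₂ ≡ h₂ + π₂ → x₃ + σ₃ ≡ h₃ + π₃ →
  (π₁ + π₃ + 2 * σ₂) % n ≡ (σ₁ + σ₃ + 2 * π₂) % n
balanced-mod {n} {x₁} {x₂} {x₃} σ₁ σ₂ σ₃ π₁ π₂ π₃ (divides m₁ refl) (divides m₂ refl) (divides m₃ refl) b f₁ f₂ f₃ = begin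
  (π₁ + π₃ + 2 * σ₂) % n                       ≡⟨ [m+kn]%n≡m%n _ (m₁ + m₃) n ⟨
  (π₁ + π₃ + 2 * σ₂ + (m₁ + m₃) * n) % n       ≡⟨ cong (_% n) chain ⟩
  (σ₁ + σ₃ + 2 * π₂ + (m₂ + m₂) * n) % n       ≡⟨ [m+kn]%n≡m%n _ (m₂ + m₂) n ⟩
  (σ₁ + σ₃ + 2 * π₂) % n                       ∎
  where
  open ≡-Reasoning
  l₁ : ∀ n π₁ π₃ σ₂ m₁ m₃ → π₁ + π₃ + 2 * σ₂ + (m₁ + m₃) * n ≡ (m₁ * n + π₁) + (m₃ * n + π₃) + 2 * σ₂
  l₁ = solve-∀
  l₂ : ∀ x₁ x₃ σ₁ σ₂ σ₃ → (x₁ + σ₁) + (x₃ + σ₃) + 2 * σ₂ ≡ (x₁ + x₃) + (σ₁ + σ₃ + 2 * σ₂)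
  l₂ = solve-∀
  l₃ : ∀ x₂ σ₁ σ₂ σ₃ → (x₂ + x₂) + (σ₁ + σ₃ + 2 * σ₂) ≡ σ₁ + σ₃ + 2 * (x₂ + σ₂)
  l₃ = solve-∀
  l₄ : ∀ n σ₁ σ₃ m₂ π₂ → σ₁ + σ₃ + 2 * (m₂ * n + π₂) ≡ σ₁ + σ₃ + 2 * π₂ + (m₂ + m₂) * n
  l₄ = solve-∀
  chain : π₁ + π₃ + 2 * σ₂ + (m₁ + m₃) * n ≡ σ₁ + σ₃ + 2 * π₂ + (m₂ + m₂) * n
  chain = begin
    _ ≡⟨ l₁ n π₁ π₃ σ₂ m₁ m₃ ⟩
    _ ≡⟨ cong₂ (λ s t → s + t + 2 * σ₂) f₁ f₃ ⟨
    _ ≡⟨ l₂ x₁ x₃ σ₁ σ₂ σ₃ ⟩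
    _ ≡⟨ cong (_+ (σ₁ + σ₃ + 2 * σ₂)) b ⟩
    _ ≡⟨ l₃ x₂ σ₁ σ₂ σ₃ ⟩
    _ ≡⟨ cong (λ s → σ₁ + σ₃ + 2 * s) f₂ ⟩
    _ ≡⟨ l₄ n σ₁ σ₃ m₂ π₂ ⟩
    _ ∎

-- A common `σ` and `π` cancel; this moves three cuts at the same place of an image to image
-- boundaries.
balanced-cancel : ∀ {x₁ x₂ x₃ h₁ h₂ h₃} σ π → x₁ + x₃ ≡ x₂ + x₂ →
  x₁ + σ ≡ h₁ + π → x₂ + σ ≡ h₂ + π → x₃ + σ ≡ h₃ + π → h₁ + h₃ ≡ h₂ + h₂
balanced-cancel {x₁} {x₂} {x₃} {h₁} {h₂} {h₃} σ π b f₁ f₂ f₃ = +-cancelʳ-≡ (π + π) _ _ (trans (swap h₁ h₃ π)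
  (trans (cong₂ _+_ (sym f₁) (sym f₃)) (trans (sym (swap x₁ x₃ σ)) (trans (cong (_+ (σ + σ)) b)
    (trans (swap x₂ x₂ σ) (trans (cong₂ _+_ f₂ f₂) (sym (swap h₂ h₂ π))))))))
  where
  swap : ∀ a b c → a + b + (c + c) ≡ (a + c) + (b + c)
  swap a b c = interchange a b c c

morphism-abelianSquareFree : ∀ {w} → AbelianSquareFree w → AbelianSquareFree (morphism w)
morphism-abelianSquareFree {w} sf X Y Z eqX eqY eqZ bal =
  conclude (cutAt-prefix w X eqX) (cutAt-prefix w Y eqY) (cutAt-prefix w Z eqZ)
  where
  conclude : CutAt w X → CutAt w Y → CutAt w Z → ∀ f → wt f X ≡ wt f Y
  conclude (cutAt {w₁} s₁ {c₁} c₁∈ e₁) (cutAt {w₂} s₂ {c₂} c₂∈ e₂) (cutAt {w₃} s₃ {c₃} c₃∈ e₃)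
    with aligned c₁∈ c₂∈ c₃∈ (balanced-mod
      {x₁ = wt hash X} {wt hash Y} {wt hash Z} {wt hash (morphism w₁)} {wt hash (morphism w₂)} {wt hash (morphism w₃)}
      (wt hash (proj₂ c₁)) (wt hash (proj₂ c₂)) (wt hash (proj₂ c₃))
      (wt hash (proj₁ c₁)) (wt hash (proj₁ c₂)) (wt hash (proj₁ c₃))
      (317∣wt-hash-morphism w₁) (317∣wt-hash-morphism w₂) (317∣wt-hash-morphism w₃)
      (bal hash) (e₁ hash) (e₂ hash) (e₃ hash))
  ... | refl , refl = λ f → +-cancelʳ-≡ (wt f (proj₂ c₂)) _ _ (begin
    wt f X + wt f (proj₂ c₂)             ≡⟨ e₁ f ⟩
    wt f (morphism w₁) + wt f (proj₁ c₂) ≡⟨ cong (_+ wt f (proj₁ c₂)) (same f) ⟩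
    wt f (morphism w₂) + wt f (proj₁ c₂) ≡⟨ e₂ f ⟨
    wt f Y + wt f (proj₂ c₂)             ∎)
    where
    open ≡-Reasoning
    balanced : Balanced (morphism w₁) (morphism w₂) (morphism w₃)
    balanced f = balanced-cancel {wt f X} {wt f Y} {wt f Z}
      {wt f (morphism w₁)} {wt f (morphism w₂)} {wt f (morphism w₃)}
      (wt f (proj₂ c₂)) (wt f (proj₁ c₂)) (bal f) (e₁ f) (e₂ f) (e₃ f)
    same : ∀ f → wt f (morphism w₁) ≡ wt f (morphism w₂)
    same f = trans (wt-concatMap f image w₁) (trans
      -- The weight used on the preimage is that of whole images; this is where the conclusion of
      -- `AbelianSquareFree` for all weights is used.
      (sf w₁ w₂ w₃ s₁ s₂ s₃ (balanced-morphism⁻¹ {w₁} {w₂} {w₃} balanced) (wt f ∘ image))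
      (sym (wt-concatMap f image w₂)))

singleton-abelianSquareFree : ∀ a → AbelianSquareFree (a ∷ [])
singleton-abelianSquareFree a []          []          Z           _  _  _  bal f = refl
singleton-abelianSquareFree a (x ∷ [])    (y ∷ [])    Z           refl refl _ bal f = refl
singleton-abelianSquareFree a []          (_ ∷ [])    []          _  _  _  bal = contradiction (bal (const 1)) λ ()
singleton-abelianSquareFree a []          (_ ∷ [])    (_ ∷ [])    _  _  _  bal = contradiction (bal (const 1)) λ ()
singleton-abelianSquareFree a []          (_ ∷ [])    (_ ∷ _ ∷ _) _  _  () bal
singleton-abelianSquareFree a (_ ∷ [])    []          Z           _  _  _  bal = contradiction (bal (const 1)) λ ()
singleton-abelianSquareFree a (_ ∷ _ ∷ _) Y           Z           () _  _  bal
singleton-abelianSquareFree a X           (_ ∷ _ ∷ _) Z           _  () _  bal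

-- Iterates of the morphism as letter sequences.

word : ℕ → Word
word zero    = 0F ∷ []
word (suc n) = morphism (word n)

word-abelianSquareFree : ∀ n → AbelianSquareFree (word n)
word-abelianSquareFree zero    = singleton-abelianSquareFree 0F
word-abelianSquareFree (suc n) = morphism-abelianSquareFree (word-abelianSquareFree n)

2*length≤length-morphism : ∀ w → 2 * length w ≤ length (morphism w)
2*length≤length-morphism []      = z≤n
2*length≤length-morphism (a ∷ w) = subst₂ _≤_ (sym (*-suc 2 (length w))) (sym (List.length-++ (image a)))
  (+-mono-≤ (2≤length-image a) (2*length≤length-morphism w))
  where
  2≤length-image : ∀ a → 2 ≤ length (image a)
  2≤length-image = from-yes (Fin.all? λ a → 2 ≤? length (image a))

2^n≤length-word : ∀ n → 2 ^ n ≤ length (word n)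
2^n≤length-word zero    = s≤s z≤n
2^n≤length-word (suc n) = ≤-trans (*-monoʳ-≤ 2 (2^n≤length-word n)) (2*length≤length-morphism (word n))

n<2^n : ∀ n → n < 2 ^ n
n<2^n zero    = s≤s z≤n
n<2^n (suc n) = ≤-trans (+-mono-≤ (m^n>0 2 n) (n<2^n n)) (≤-reflexive (cong (2 ^ n +_) (sym (+-identityʳ (2 ^ n)))))

-- The value `0F` past the end is a default; prefix sums are identified with weights only up to the
-- length of the word.
nth : Word → ℕ → Letter
nth []      i       = 0F
nth (a ∷ w) zero    = a
nth (a ∷ w) (suc i) = nth w i

∑-suc : ∀ n (g : ℕ → ℕ) → ∑ (suc n) g ≡ g 0 + ∑ n (g ∘ suc)
∑-suc zero    g = +-comm 0 (g 0)
∑-suc (suc n) g = trans (cong (_+ g (suc n)) (∑-suc n g)) (+-assoc (g 0) _ _)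

wt-take : ∀ f w {n} → n ≤ length w → wt f (take n w) ≡ ∑ n (f ∘ nth w)
wt-take f w       {zero}  _         = refl
wt-take f (a ∷ w) {suc n} (s≤s n≤l) = trans (cong (f a +_) (wt-take f w n≤l)) (sym (∑-suc n (f ∘ nth (a ∷ w))))

∑-1 : ∀ n → ∑ n (const 1) ≡ n
∑-1 n = trans (∑-const 1 n) (*-identityʳ n)

-- The iterate `word N` has at least `2 ^ N` letters, more than `N`. Prefixes are now given by their
-- lengths, which the weight `const 1` compares.
abelianSquareFree : ∀ N → ∃ λ (B : ℕ → Letter) → ∀ {x y z} → x ≤ N → y ≤ N → z ≤ N →
  (∀ f → ∑ x (f ∘ B) + ∑ z (f ∘ B) ≡ ∑ y (f ∘ B) + ∑ y (f ∘ B)) → x ≡ y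
abelianSquareFree N = nth w , λ {x} {y} {z} x≤ y≤ z≤ bal →
  let eq = word-abelianSquareFree N (take x w) (take y w) (take z w)
             (List.take++drop≡id x w) (List.take++drop≡id y w) (List.take++drop≡id z w)
             (λ f → trans (cong₂ _+_ (at f x≤) (at f z≤)) (trans (bal f) (sym (cong₂ _+_ (at f y≤) (at f y≤))))) (const 1)
  in trans (sym (∑-1 x)) (trans (sym (at (const 1) x≤)) (trans eq (trans (at (const 1) y≤) (∑-1 y))))
  where
  w = word N
  at : ∀ f {n} → n ≤ N → wt f (take n w) ≡ ∑ n (f ∘ nth w)
  at f n≤N = wt-take f w (≤-trans n≤N (≤-trans (<⇒≤ (n<2^n N)) (2^n≤length-word N)))

-- Splitting paths, and weights of duplicate-free lists.

Unique-++⁻ : {A : Set} (xs : List A) {ys : List A} → Unique (xs ++ ys) →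
  Unique xs × Unique ys × (∀ {v} → v ∈ xs → v ∉ ys)
Unique-++⁻ []       u        = [] , u , λ ()
Unique-++⁻ (x ∷ xs) (px ∷ u) with Unique-++⁻ xs u
... | uˡ , uʳ , disj = ++⁻ˡ xs px ∷ uˡ , uʳ ,
  λ { (here refl) v∈ys → All.lookup (++⁻ʳ xs px) v∈ys refl ; (there v∈xs) → disj v∈xs }

Linked-++⁻ : {A : Set} {R : A → A → Set} (xs : List A) {ys : List A} → Linked R (xs ++ ys) →
  Linked R xs × Linked R ys
Linked-++⁻ []           l       = [] , l
Linked-++⁻ (x ∷ [])     [-]     = [-] , []
Linked-++⁻ (x ∷ [])     (_ ∷ l) = [-] , l
Linked-++⁻ (x ∷ y ∷ xs) (r ∷ l) = let lˡ , lʳ = Linked-++⁻ (y ∷ xs) l in r ∷ lˡ , lʳ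

map-++⁻ : {A B : Set} (f : A → B) (vs : List A) (xs : List B) {ys : List B} → map f vs ≡ xs ++ ys →
  ∃₂ λ us ws → vs ≡ us ++ ws × map f us ≡ xs × map f ws ≡ ys
map-++⁻ f vs       []       eq = [] , vs , refl , refl , eq
map-++⁻ f (v ∷ vs) (x ∷ xs) eq with List.∷-injective eq
... | refl , eq′ with map-++⁻ f vs xs eq′
...   | us , ws , refl , refl , refl = v ∷ us , ws , refl , refl , refl

module _ {A : Set} (g : A → ℕ) where

  ≤-wt : ∀ {v X} → v ∈ X → g v ≤ wt g X
  ≤-wt (here refl)         = m≤m+n _ _
  ≤-wt {X = x ∷ X} (there v∈) = ≤-trans (≤-wt v∈) (m≤n+m _ (g x))

  wt≢0⇒∃ : ∀ X → wt g X ≢ 0 → ∃[ v ] v ∈ X × g v ≢ 0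
  wt≢0⇒∃ []      nz = contradiction refl nz
  wt≢0⇒∃ (x ∷ X) nz with g x ≟ 0
  ... | no gx≢0  = x , here refl , gx≢0
  ... | yes gx≡0 = let v , v∈ , gv = wt≢0⇒∃ X (λ eq → nz (cong₂ _+_ gx≡0 eq)) in v , there v∈ , gv

  wt-unique≤1 : (∀ v → g v ≤ 1) → (∀ {v w} → g v ≢ 0 → g w ≢ 0 → v ≡ w) → ∀ {X} → Unique X → wt g X ≤ 1
  wt-unique≤1 ≤1 inj []       = z≤n
  wt-unique≤1 ≤1 inj {x ∷ X} (px ∷ u) with g x ≟ 0
  ... | yes gx≡0 = subst (λ c → c + wt g X ≤ 1) (sym gx≡0) (wt-unique≤1 ≤1 inj u)
  ... | no gx≢0 with wt g X ≟ 0
  ...   | yes eq = subst (λ c → g x + c ≤ 1) (sym eq) (subst (_≤ 1) (sym (+-identityʳ (g x))) (≤1 x))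
  ...   | no neq = let v , v∈ , gv = wt≢0⇒∃ X neq in contradiction (inj gx≢0 gv) (All.lookup px v∈)

-- Binary sums, pigeonhole and parity.

≤1-cong : ∀ {a b} → a ≤ 1 → b ≤ 1 → (a ≢ 0 → b ≢ 0) → (b ≢ 0 → a ≢ 0) → a ≡ b
≤1-cong z≤n       z≤n       _ _ = refl
≤1-cong z≤n       (s≤s z≤n) _ h = contradiction refl (h λ ())
≤1-cong (s≤s z≤n) z≤n       h _ = contradiction refl (h λ ())
≤1-cong (s≤s z≤n) (s≤s z≤n) _ _ = refl

∑-2^<2^ : ∀ t {x : ℕ → ℕ} → (∀ r → x r ≤ 1) → ∑ t (λ r → 2 ^ r * x r) < 2 ^ t
∑-2^<2^ zero    x≤1 = s≤s z≤n
∑-2^<2^ (suc t) {x} x≤1 = +-mono-<-≤ (∑-2^<2^ t x≤1) (≤-trans (*-monoʳ-≤ (2 ^ t) (x≤1 t))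
  (≤-reflexive (*-comm (2 ^ t) 1)))

disjoint-binary : ∀ t {x y : ℕ → ℕ} → (∀ r → x r + y r ≤ 1) →
  ∑ t (λ r → 2 ^ r * x r) ≡ ∑ t (λ r → 2 ^ r * y r) → ∀ {r} → r < t → x r ≡ 0 × y r ≡ 0
disjoint-binary (suc t) {x} {y} xy≤1 eq {r} r<1+t =
  go (x t) (y t) refl refl (xy≤1 t) (m≤n⇒m<n∨m≡n (m<1+n⇒m≤n r<1+t))
  where
  low : ∀ {u v} → (∀ r → u r + v r ≤ 1) → ∑ t (λ r → 2 ^ r * u r) < 2 ^ t
  low uv≤1 = ∑-2^<2^ t (λ r → m+n≤o⇒m≤o _ (uv≤1 r))
  yx≤1 : ∀ r → y r + x r ≤ 1
  yx≤1 r = subst (_≤ 1) (+-comm (x r) (y r)) (xy≤1 r)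
  absurd : ∀ {u v : ℕ → ℕ} → u t ≡ 0 → v t ≡ 1 → (∀ r → u r + v r ≤ 1) →
    ∑ (suc t) (λ r → 2 ^ r * u r) ≢ ∑ (suc t) (λ r → 2 ^ r * v r)
  absurd {u} {v} ut vt uv≤1 e = <-irrefl e (<-≤-trans
    (subst (_< 2 ^ t) (sym (trans (cong (λ c → ∑ t (λ r → 2 ^ r * u r) + 2 ^ t * c) ut)
      (trans (cong (∑ t (λ r → 2 ^ r * u r) +_) (*-zeroʳ (2 ^ t))) (+-identityʳ _)))) (low {u} {v} uv≤1))
    (≤-trans (≤-reflexive (sym (trans (cong (2 ^ t *_) vt) (*-identityʳ (2 ^ t))))) (m≤n+m _ _)))
  go : ∀ a b → x t ≡ a → y t ≡ b → a + b ≤ 1 → r < t ⊎ r ≡ t → x r ≡ 0 × y r ≡ 0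
  go 0 0 xt yt _ (inj₂ refl) = xt , yt
  go 0 0 xt yt _ (inj₁ r<t)  = disjoint-binary t xy≤1 (+-cancelʳ-≡ (2 ^ t * 0) _ _
    (subst₂ (λ a b → ∑ t (λ r → 2 ^ r * x r) + 2 ^ t * a ≡ ∑ t (λ r → 2 ^ r * y r) + 2 ^ t * b) xt yt eq)) r<t
  go 0 1 xt yt _ _ = contradiction eq (absurd xt yt xy≤1)
  go 1 0 xt yt _ _ = contradiction (sym eq) (absurd yt xt yx≤1)
  go 1 (suc b) _ _ (s≤s ()) _
  go 0 (suc (suc b)) _ _ (s≤s ()) _
  go (suc (suc a)) b _ _ (s≤s ()) _

-- Pigeonhole: were all five numbers in the list, two of them would share a place. It will be
-- applied to the blocks of the four ends of the two halves.
fresh : (js : List ℕ) → length js < 5 → ∃[ j ] toℕ {5} j ∉ js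
fresh js l<5 with Fin.any? (λ j → ¬? (toℕ {5} j ∈ℕ? js))
... | yes p = p
... | no ¬p = contradiction (Fin.pigeonhole l<5 (Any.index ∘ mem)) λ (i , j , i<j , eq) →
  <⇒≢ i<j (trans (lookup-index (mem i)) (trans (cong (List.lookup js) eq) (sym (lookup-index (mem j)))))
  where
  mem : (j : Fin 5) → toℕ j ∈ js
  mem j = decidable-stable (toℕ j ∈ℕ? js) (λ j∉ → ¬p (j , j∉))

-- `inj₁` marks even numbers, the positions of base letters, and `inj₂` odd ones, the positions of
-- markers.
half : ℕ → ℕ ⊎ ℕ
half zero          = inj₁ 0
half (suc zero)    = inj₂ 0
half (suc (suc a)) = Sum.map suc suc (half a)

half-even : ∀ a {q} → half a ≡ inj₁ q → a ≡ 2 * q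
half-even zero          refl = refl
half-even (suc (suc a)) eq with half a in eq′
half-even (suc (suc a)) refl | inj₁ q = trans (cong (2 +_) (half-even a eq′)) (sym (*-suc 2 q))

half-odd : ∀ a {q} → half a ≡ inj₂ q → a ≡ suc (2 * q)
half-odd (suc zero)    refl = refl
half-odd (suc (suc a)) eq with half a in eq′
half-odd (suc (suc a)) refl | inj₂ q = trans (cong (2 +_) (half-odd a eq′)) (cong suc (sym (*-suc 2 q)))

-- Position 0 is even, so the even positions below `a` number `a / 2` rounded up, and they carry the
-- values of `h` in order.
∑-half : ∀ a (h : ℕ → ℕ) → ∑ a (λ i → [ h , const 0 ]′ (half i)) ≡ ∑ ⌈ a /2⌉ h
∑-half zero          h = refl
∑-half (suc zero)    h = refl
∑-half (suc (suc a)) h = begin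
  ∑ (2 + a) F                           ≡⟨ ∑-suc (suc a) F ⟩
  h 0 + ∑ (suc a) (F ∘ suc)             ≡⟨ cong (h 0 +_) (∑-suc a (F ∘ suc)) ⟩
  h 0 + ∑ a (F ∘ suc ∘ suc)             ≡⟨ cong (h 0 +_) (∑-cong a (λ i _ → shift (half i))) ⟩
  h 0 + ∑ a (λ i → [ h ∘ suc , const 0 ]′ (half i)) ≡⟨ cong (h 0 +_) (∑-half a (h ∘ suc)) ⟩
  h 0 + ∑ ⌈ a /2⌉ (h ∘ suc)             ≡⟨ ∑-suc ⌈ a /2⌉ h ⟨
  ∑ (suc ⌈ a /2⌉) h                     ∎
  where
  open ≡-Reasoning
  F : ℕ → ℕ
  F i = [ h , const 0 ]′ (half i)
  shift : ∀ s → [ h , const 0 ]′ (Sum.map suc suc s) ≡ [ h ∘ suc , const 0 ]′ s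
  shift (inj₁ q) = refl
  shift (inj₂ q) = refl

last⁺ : {A : Set} → A → List A → A
last⁺ x []       = x
last⁺ x (y ∷ ys) = last⁺ y ys

-- Colours, and the two halves of an anagram.

data Colour (k : ℕ) : Set where
  vertex : Colour k
  base   : Fin k → Letter → Colour k
  marker : Fin k → Fin 5 → Colour k

-- Twelve codes per palette, seven letters and five markers, follow two leading codes that both
-- decode to `vertex`.
encode : ∀ {k} → Colour k → Fin (2 + 12 * k)
encode vertex       = 0F
encode (base c b)   = 2 ↑ʳ combine {12} (b ↑ˡ 5) c
encode (marker c j) = 2 ↑ʳ combine {12} (7 ↑ʳ j) c

letterColour : ∀ {k} → Fin 12 × Fin k → Colour k
letterColour (l , c) = [ base c , marker c ]′ (splitAt 7 l)

decode : ∀ {k} → Fin (2 + 12 * k) → Colour k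
decode {k} i = [ const vertex , letterColour ∘ remQuot {12} k ]′ (splitAt 2 i)

decode-encode : ∀ {k} (c : Colour k) → decode (encode c) ≡ c
decode-encode vertex       = refl
decode-encode (base c b)   = trans (cong letterColour (Fin.remQuot-combine {12} (b ↑ˡ 5) c))
  (cong [ base c , marker c ]′ (Fin.splitAt-↑ˡ 7 b 5))
decode-encode (marker c j) = trans (cong letterColour (Fin.remQuot-combine {12} (7 ↑ʳ j) c))
  (cong [ base c , marker c ]′ (Fin.splitAt-↑ʳ 7 5 j))

-- A weight on colours becomes a weight on codes through the left inverse `decode`, and sums are
-- invariant under permutation. From here on, anagrams are handled through equality of all weights.
anagram-halves : ∀ {k} {V : Set} (col : V → Colour k) (vs : List V) → IsAnagram (map (encode ∘ col) vs) →
  ∃₂ λ L R → vs ≡ L ++ R × L ≢ [] × (∀ f → wt (f ∘ col) L ≡ wt (f ∘ col) R)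
anagram-halves col vs (W , P , W≢[] , P↭W , eq) with map-++⁻ (encode ∘ col) vs W eq
... | L , R , refl , refl , refl = L , R , refl , (λ { refl → W≢[] refl }) ,
  λ f → trans (wt-encode f L) (trans (sym (sum-↭ (map⁺ (f ∘ decode) P↭W))) (sym (wt-encode f R)))
  where
  wt-encode : ∀ f X → wt (f ∘ col) X ≡ wt (f ∘ decode) (map (encode ∘ col) X)
  wt-encode f X = trans (wt-cong (λ v → cong f (sym (decode-encode (col v)))) X) (cong sum (map-∘ X))

-- Paths in a subdivision.

module _ {G : SimpleGraph} {d : Edge G → ℕ} where

  private
    S = SubdivV G d
    Adj = Graph.Adj (subdivision G d)

  arc-functional : ∀ {p y z} → SubdivArc G d (inj₂ p) y → SubdivArc G d (inj₂ p) z → y ≡ z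
  arc-functional (arc-middle i j j₁ e₁) (arc-middle _ _ j₂ e₂) =
    cong (λ j → inj₂ (i , j)) (Fin.toℕ-injective (trans (sym e₁) e₂))
  arc-functional (arc-middle i j j₁ e₁) (arc-last _ _ e₂) =
    contradiction (trans (sym e₁) e₂) (<⇒≢ (Fin.toℕ<n j₁))
  arc-functional (arc-last i j e₁) (arc-middle _ _ j₂ e₂) =
    contradiction (trans (sym e₂) e₁) (<⇒≢ (Fin.toℕ<n j₂))
  arc-functional (arc-last i j e₁) (arc-last _ _ e₂) = refl

  arc-injective : ∀ {p y z} → SubdivArc G d y (inj₂ p) → SubdivArc G d z (inj₂ p) → y ≡ z
  arc-injective (arc-first i j e₁) (arc-first _ _ e₂) = refl
  arc-injective (arc-first i j e₁) (arc-middle _ j₂ _ e₂) = contradiction (trans (sym e₁) (sym e₂)) λ ()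
  arc-injective (arc-middle i j₁ j e₁) (arc-first _ _ e₂) = contradiction (trans (sym e₂) (sym e₁)) λ ()
  arc-injective (arc-middle i j₁ j e₁) (arc-middle _ j₂ _ e₂) =
    cong (λ j → inj₂ (i , j)) (Fin.toℕ-injective (suc-injective (trans e₁ (sym e₂))))

  -- A division vertex has one incoming and one outgoing arc; two distinct neighbours exhaust both.
  degree≤2 : ∀ {p x y z} → Adj (inj₂ p) x → Adj (inj₂ p) y → x ≢ y → Adj (inj₂ p) z → z ≡ x ⊎ z ≡ y
  degree≤2 (inj₁ a) (inj₁ b) x≢y c        = contradiction (arc-functional a b) x≢y
  degree≤2 (inj₂ a) (inj₂ b) x≢y c        = contradiction (arc-injective a b) x≢y
  degree≤2 (inj₁ a) (inj₂ b) x≢y (inj₁ c) = inj₁ (arc-functional c a)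
  degree≤2 (inj₁ a) (inj₂ b) x≢y (inj₂ c) = inj₂ (arc-injective c b)
  degree≤2 (inj₂ a) (inj₁ b) x≢y (inj₁ c) = inj₂ (arc-functional c b)
  degree≤2 (inj₂ a) (inj₁ b) x≢y (inj₂ c) = inj₁ (arc-injective c a)

  Adj-sym : ∀ {x y} → Adj x y → Adj y x
  Adj-sym = Sum.swap

  -- A division vertex in the interior of a path has two distinct neighbours on the path, so by
  -- `degree≤2` it has none elsewhere.
  neighbour∈ : ∀ {p z} x X → Linked Adj (x ∷ X) → Unique (x ∷ X) →
    inj₂ p ∈ x ∷ X → inj₂ p ≢ x → inj₂ p ≢ last⁺ x X → Adj (inj₂ p) z → z ∈ x ∷ X
  neighbour∈ x X _ _ (here eq) ≢x _ _ = contradiction eq ≢x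
  neighbour∈ x (_ ∷ []) _ _ (there (here eq)) _ ≢l _ = contradiction eq ≢l
  neighbour∈ x (_ ∷ y ∷ X) (l₁ ∷ l₂ ∷ _) ((_ ∷ x≢y ∷ _) ∷ _) (there (here refl)) _ _ a
    with degree≤2 (Adj-sym l₁) l₂ x≢y a
  ... | inj₁ refl = here refl
  ... | inj₂ refl = there (there (here refl))
  neighbour∈ x (x′ ∷ y ∷ X) (_ ∷ l) (_ ∷ u@(px ∷ _)) (there (there p∈)) _ ≢l a =
    there (neighbour∈ x′ (y ∷ X) l u (there p∈) (λ eq → All.lookup px p∈ (sym eq)) ≢l a)

  data Up (e : Edge G) : ℕ → List S → Set where
    []  : ∀ {a} → Up e a []
    _∷_ : ∀ {a j X} → toℕ j ≡ a → Up e (suc a) X → Up e a (inj₂ (e , j) ∷ X)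

  -- The index is one more than the position of the head.
  data Down (e : Edge G) : ℕ → List S → Set where
    []  : ∀ {a} → Down e a []
    _∷_ : ∀ {a j X} → toℕ j ≡ a → Down e a X → Down e (suc a) (inj₂ (e , j) ∷ X)

  -- Without original vertices every step is an `arc-middle`, so the edge never changes; a change of
  -- direction would repeat the vertex before the turn.
  monotone : ∀ {X} → Linked Adj X → Unique X → (∀ v → inj₁ v ∉ X) → X ≢ [] →
    ∃ λ e → (∃ λ a → Up e a X) ⊎ (∃ λ a → Down e a X)
  monotone []                      _  _    ne = contradiction refl ne
  monotone ([-] {inj₁ v})          _  none _  = contradiction (here refl) (none v)
  monotone ([-] {inj₂ (e , j)})    _  _    _  = e , inj₁ (toℕ j , refl ∷ [])
  monotone (inj₁ (arc-direct i _) ∷ _)  _ none _ = contradiction (here refl) (none _)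
  monotone (inj₁ (arc-first i _ _) ∷ _) _ none _ = contradiction (here refl) (none _)
  monotone (inj₁ (arc-last i _ _) ∷ _)  _ none _ = contradiction (there (here refl)) (none _)
  monotone (inj₂ (arc-direct i _) ∷ _)  _ none _ = contradiction (here refl) (none _)
  monotone (inj₂ (arc-first i _ _) ∷ _) _ none _ = contradiction (there (here refl)) (none _)
  monotone (inj₂ (arc-last i _ _) ∷ _)  _ none _ = contradiction (here refl) (none _)
  monotone (inj₁ (arc-middle i j j′ eq) ∷ l) (px ∷ u) none _ with monotone l u (λ v → none v ∘ there) (λ ())
  ... | _ , inj₁ (_ , refl ∷ up)          = i , inj₁ (toℕ j , refl ∷ (sym eq ∷ subst (λ a → Up i (suc a) _) (sym eq) up))
  ... | e , inj₂ (suc a , j′≡a ∷ [])      = e , inj₁ (toℕ j , refl ∷ (sym eq ∷ []))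
  ... | _ , inj₂ (suc (suc a) , j′≡a ∷ (j″≡ ∷ _)) = contradiction
    (cong (λ j → inj₂ (i , j)) (Fin.toℕ-injective (suc-injective (trans eq (trans j′≡a (cong suc (sym j″≡)))))))
    (All.lookup px (there (here refl)))
  monotone (inj₂ (arc-middle i j j′ eq) ∷ l) (px ∷ u) none _ with monotone l u (λ v → none v ∘ there) (λ ())
  ... | _ , inj₂ (_ , refl ∷ down)        = i , inj₂ (_ , sym eq ∷ (refl ∷ down))
  -- A single vertex is reported as `Up`, but can equally end a descent.
  ... | _ , inj₁ (_ , refl ∷ [])          = i , inj₂ (_ , sym eq ∷ (refl ∷ []))
  ... | _ , inj₁ (_ , refl ∷ (j″≡ ∷ _))   = contradiction
    (cong (λ j → inj₂ (i , j)) (Fin.toℕ-injective (trans (sym eq) (sym j″≡))))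
    (All.lookup px (there (here refl)))

  Follows : Edge G → (ℕ → ℕ) → (S → ℕ) → Set
  Follows e F g = ∀ j → g (inj₂ (e , j)) ≡ F (toℕ j)

  -- Telescoping: the weight of a run is a difference of two prefix sums of `F`, written additively.
  up-prefix : ∀ {e a} X {Y} → Up e a (X ++ Y) →
    Up e (a + length X) Y × (∀ F g → Follows e F g → ∑ a F + wt g X ≡ ∑ (a + length X) F)
  up-prefix {e} {a} [] {Y} up = subst (λ a → Up e a Y) (sym (+-identityʳ a)) up ,
    λ F g _ → trans (+-identityʳ (∑ a F)) (cong (λ a → ∑ a F) (sym (+-identityʳ a)))
  up-prefix {e} {a} (_ ∷ X) {Y} (refl ∷ up) = let up′ , eq = up-prefix X up in
    subst (λ b → Up e b Y) (sym (+-suc a (length X))) up′ ,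
    λ F g fol → trans (sym (+-assoc (∑ a F) _ (wt g X))) (trans (cong (λ c → ∑ a F + c + wt g X) (fol _))
      (trans (eq F g fol) (cong (λ b → ∑ b F) (sym (+-suc a (length X))))))

  down-prefix : ∀ {e a} X {Y} → Down e a (X ++ Y) →
    ∃ λ c → a ≡ c + length X × Down e c Y × (∀ F g → Follows e F g → ∑ c F + wt g X ≡ ∑ a F)
  down-prefix {a = a} [] down = a , sym (+-identityʳ a) , down , λ F g _ → +-identityʳ (∑ a F)
  down-prefix (_ ∷ X) (_∷_ {a} refl down) = let c , len , down′ , eq = down-prefix X down in
    c , trans (cong suc len) (sym (+-suc c (length X))) , down′ ,
    λ F g fol → trans (swap (∑ c F) _ (wt g X)) (cong₂ _+_ (eq F g fol) (fol _))
    where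
    swap : ∀ a b c → a + (b + c) ≡ a + c + b
    swap = solve-∀

  up-bound : ∀ {e a X} → Up e a X → X ≢ [] → a + length X ≤ d e
  up-bound [] ne = contradiction refl ne
  up-bound {a = a} (_∷_ {j = j} refl []) _ = ≤-trans (≤-reflexive (+-comm a 1)) (Fin.toℕ<n j)
  up-bound {a = a} (_∷_ {X = X} refl up@(_ ∷ _)) _ = ≤-trans (≤-reflexive (+-suc a (length X))) (up-bound up λ ())

  down-bound : ∀ {e a X} → Down e a X → X ≢ [] → a ≤ d e
  down-bound []                   ne = contradiction refl ne
  down-bound (_∷_ {j = j} refl _) _  = Fin.toℕ<n j

  balance-sums : ∀ {x y z l r} → x + l ≡ y → y + r ≡ z → l ≡ r → x + z ≡ y + y
  balance-sums {x} {l = l} refl refl refl = lemma x l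
    where
    lemma : ∀ x l → x + (x + l + l) ≡ x + l + (x + l)
    lemma = solve-∀

  -- Both directions give the same kind of balance between three prefix sums. On a descent `R` lies
  -- nearer to the source than `L`, so the lowest cut is the end of `R` and the two halves exchange
  -- roles.
  run-sums : ∀ {e} L R → (∃ λ a → Up e a (L ++ R)) ⊎ (∃ λ a → Down e a (L ++ R)) → L ≢ [] → length L ≡ length R →
    ∃ λ x → x + length L + length L ≤ d e ×
      (∀ F g → Follows e F g → wt g L ≡ wt g R →
        ∑ x F + ∑ (x + length L + length L) F ≡ ∑ (x + length L) F + ∑ (x + length L) F)
  run-sums {e} L R (inj₁ (a , up)) L≢[] len with up-prefix L up
  ... | up′ , eqL with up-prefix R (subst (Up e (a + length L)) (sym (List.++-identityʳ R)) up′)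
  ...   | _ , eqR = a , bound , λ F g fol eq → balance-sums (eqL F g fol) (trans (eqR F g fol) (cong (λ l → ∑ (a + length L + l) F) (sym len))) eq
    where
    bound : a + length L + length L ≤ d e
    bound = subst (λ l → l ≤ d e) (trans (cong (a +_) (trans (List.length-++ L) (cong (length L +_) (sym len)))) (sym (+-assoc a _ _)))
      (up-bound up (L≢[] ∘ List.++-conicalˡ L R))
  run-sums {e} L R (inj₂ (a , down)) L≢[] len with down-prefix L down
  ... | c , lenL , down′ , eqL with down-prefix R (subst (Down e c) (sym (List.++-identityʳ R)) down′)
  ...   | b , lenR , _ , eqR = b , subst (_≤ d e) a≡ (down-bound down (L≢[] ∘ List.++-conicalˡ L R)) ,
    λ F g fol eq → balance-sums (trans (eqR F g fol) (cong (λ l → ∑ l F) c≡)) 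
      (trans (cong (λ y → ∑ y F + wt g L) (sym c≡)) (trans (eqL F g fol) (cong (λ l → ∑ l F) a≡))) (sym eq)
    where
    c≡ : c ≡ b + length L
    c≡ = trans lenR (cong (b +_) (sym len))
    a≡ : a ≡ b + length L + length L
    a≡ = trans lenL (cong (_+ length L) c≡)

-- Quotients and indicator values.

/-unique : ∀ {a} j n .{{_ : NonZero n}} → j * n ≤ a → a < suc j * n → a / n ≡ j
/-unique {a} j n lo hi = ≤-antisym (m<1+n⇒m≤n (m<n*o⇒m/o<n hi))
  (subst (_≤ a / n) (m*n/n≡m j n) (/-monoˡ-≤ n lo))

ι-⇔ : ∀ {i j k l} → (i ≡ j → k ≡ l) → (k ≡ l → i ≡ j) → ι i j ≡ ι k l
ι-⇔ {i} {j} {k} {l} to from with i ≟ j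
... | yes eq = trans (ι-≡ eq) (sym (ι-≡ (to eq)))
... | no neq = trans (ι-≢ neq) (sym (ι-≢ (neq ∘ from)))

ι≤1 : ∀ i j → ι i j ≤ 1
ι≤1 i j with i ≟ j
... | yes eq = ≤-reflexive (ι-≡ eq)
... | no neq = ≤-trans (≤-reflexive (ι-≢ neq)) z≤n

ι≢0⇒≡ : ∀ {i j} → ι i j ≢ 0 → i ≡ j
ι≢0⇒≡ {i} {j} nz with i ≟ j
... | yes eq = eq
... | no neq = contradiction (ι-≢ neq) nz

-- The subdivision and its colouring.

module Construction (G : SimpleGraph) (k : ℕ) .{{_ : NonZero k}} where

  t : ℕ
  t = ⌈ numEdges G / k ⌉

  -- Edge number `i` is its rank times `k` plus its palette, so distinct edges of one palette have
  -- distinct ranks.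
  rank : Edge G → ℕ
  rank e = toℕ e / k

  palette : Edge G → Fin k
  palette e = toℕ e mod k

  2^≢0 : ∀ r → NonZero (2 ^ r)
  2^≢0 r = m^n≢0 2 r

  _/2^_ : ℕ → ℕ → ℕ
  q /2^ r = _/_ q (2 ^ r) {{2^≢0 r}}

  -- Five blocks of 2 ^ rank e base letters, each letter followed by a marker.
  d : Edge G → ℕ
  d e = 2 * (5 * 2 ^ rank e)

  rank<t : ∀ e → rank e < t
  rank<t e = ≤-trans (≤-reflexive suc-rank) (/-monoˡ-≤ k (subst (toℕ e + k ≤_) (sym (+-∸-comm k 1≤m)) (+-monoˡ-≤ k e≤)))
    where
    1≤m : 1 ≤ numEdges G
    1≤m = ≤-trans (s≤s z≤n) (Fin.toℕ<n e)
    e≤ : toℕ e ≤ numEdges G ∸ 1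
    e≤ = ∸-monoˡ-≤ 1 (Fin.toℕ<n e)
    suc-rank : suc (rank e) ≡ (toℕ e + k) / k
    suc-rank = sym (trans (m/n≡1+[m∸n]/n (m≤n+m k (toℕ e))) (cong (λ x → suc (x / k)) (m+n∸n≡m (toℕ e) k)))

  d≤ : ∀ e → d e ≤ 3 * 4 ^ t
  d≤ e = begin
    2 * (5 * 2 ^ rank e)   ≡⟨ *-assoc 2 5 (2 ^ rank e) ⟨
    -- Rounding 10 up to 12 supplies a factor 4, which raises the exponent to `suc (rank e)`, at
    -- most `t`.
    10 * 2 ^ rank e        ≤⟨ *-mono-≤ (m≤n+m 10 2) (^-monoˡ-≤ (rank e) (m≤n+m 2 2)) ⟩
    12 * 4 ^ rank e        ≡⟨ *-assoc 3 4 (4 ^ rank e) ⟩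
    3 * 4 ^ suc (rank e)   ≤⟨ *-monoʳ-≤ 3 (^-monoʳ-≤ 4 (rank<t e)) ⟩
    3 * 4 ^ t              ∎
    where open ≤-Reasoning

  S : Set
  S = SubdivV G d

  Adj : S → S → Set
  Adj = Graph.Adj (subdivision G d)

  B : ℕ → Letter
  B = proj₁ (abelianSquareFree (5 * 2 ^ t))

  -- The `mod 5` only casts to `Fin 5`: along the edge `q` is below `5 * 2 ^ rank e`, so the
  -- quotient is already the block number.
  edgeColour : Edge G → ℕ → Colour k
  edgeColour e a = [ (λ q → base (palette e) (B q)) , (λ q → marker (palette e) ((q /2^ rank e) mod 5)) ]′ (half a)

  colour : S → Colour k
  colour (inj₁ v)       = vertex
  colour (inj₂ (e , p)) = edgeColour e (toℕ p)

  -- Natural-number indices let sums run over edges and positions that do not exist, where the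
  -- indicator is zero.
  at : ℕ → ℕ → S → ℕ
  at i a (inj₁ v)       = 0
  at i a (inj₂ (e , p)) = ι i (toℕ e) * ι a (toℕ p)

  at-self : ∀ e p → at (toℕ e) (toℕ p) (inj₂ (e , p)) ≡ 1
  at-self e p = cong₂ _*_ (ι-≡ {toℕ e} refl) (ι-≡ {toℕ p} refl)

  at≤1 : ∀ i a v → at i a v ≤ 1
  at≤1 i a (inj₁ v)       = z≤n
  at≤1 i a (inj₂ (e , p)) = *-mono-≤ (ι≤1 i (toℕ e)) (ι≤1 a (toℕ p))

  at≢0 : ∀ {i a} v → at i a v ≢ 0 → ∃₂ λ e p → v ≡ inj₂ (e , p) × i ≡ toℕ e × a ≡ toℕ p
  at≢0 (inj₁ v)       nz = contradiction refl nz
  at≢0 {i} {a} (inj₂ (e , p)) nz = e , p , refl , ι≢0⇒≡ (λ z → nz (cong (_* ι a (toℕ p)) z)) ,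
    ι≢0⇒≡ (λ z → nz (trans (cong (ι i (toℕ e) *_) z) (*-zeroʳ (ι i (toℕ e)))))

  at-injective : ∀ {i a v w} → at i a v ≢ 0 → at i a w ≢ 0 → v ≡ w
  at-injective {v = v} {w} nv nw with at≢0 v nv | at≢0 w nw
  ... | e , p , refl , refl , refl | e′ , p′ , refl , e≡ , p≡ with Fin.toℕ-injective e≡
  ...   | refl with Fin.toℕ-injective p≡
  ...     | refl = refl

  count : ℕ → ℕ → List S → ℕ
  count i a = wt (at i a)

  count≤1 : ∀ i a {X} → Unique X → count i a X ≤ 1
  count≤1 i a = wt-unique≤1 (at i a) (at≤1 i a) at-injective

  ∈⇒count≢0 : ∀ {e p X} → inj₂ (e , p) ∈ X → count (toℕ e) (toℕ p) X ≢ 0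
  ∈⇒count≢0 {e} {p} v∈ z = contradiction (subst₂ _≤_ (at-self e p) z (≤-wt (at (toℕ e) (toℕ p)) v∈)) λ ()

  count≢0⇒∈ : ∀ i a X → count i a X ≢ 0 → ∃₂ λ e p → inj₂ (e , p) ∈ X × i ≡ toℕ e × a ≡ toℕ p
  count≢0⇒∈ i a X nz with wt≢0⇒∃ (at i a) X nz
  ... | v , v∈ , gv with at≢0 v gv
  ...   | e , p , refl , i≡ , a≡ = e , p , v∈ , i≡ , a≡

  -- Blocks and their markers.

  start : ℕ → ℕ → ℕ
  start j r = 2 * (j * 2 ^ r)

  start-suc : ∀ j r → start (suc j) r ≡ start j r + 2 * 2 ^ r
  start-suc j r = lemma j (2 ^ r)
    where
    lemma : ∀ j n → 2 * (n + j * n) ≡ 2 * (j * n) + 2 * n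
    lemma = solve-∀

  InBlock : ℕ → S → Set
  InBlock j (inj₁ v)       = ⊥
  InBlock j (inj₂ (e , p)) = start j (rank e) ≤ toℕ p × toℕ p < start (suc j) (rank e)

  -- The value 0 at original vertices is a default; at worst it excludes block 0 when a fresh block
  -- is chosen.
  block : S → ℕ
  block (inj₁ v)       = 0
  block (inj₂ (e , p)) = _/_ (toℕ p) (2 * 2 ^ rank e) {{m*n≢0 2 (2 ^ rank e) {{_}} {{2^≢0 (rank e)}}}}

  InBlock⇒block : ∀ {j} v → InBlock j v → block v ≡ j
  InBlock⇒block {j} (inj₂ (e , p)) (lo , hi) = /-unique j (2 * 2 ^ rank e) {{m*n≢0 2 (2 ^ rank e) {{_}} {{2^≢0 (rank e)}}}}
    (≤-trans (≤-reflexive (lemma j (2 ^ rank e))) lo) (≤-trans hi (≤-reflexive (sym (lemma (suc j) (2 ^ rank e)))))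
    where
    lemma : ∀ j n → j * (2 * n) ≡ 2 * (j * n)
    lemma = solve-∀

  start≤d : ∀ {j} e → j < 5 → start (suc j) (rank e) ≤ d e
  start≤d e j<5 = *-monoʳ-≤ 2 (*-monoˡ-≤ (2 ^ rank e) j<5)

  markerWeight : ℕ → ℕ → Colour k → ℕ
  markerWeight c j vertex         = 0
  markerWeight c j (base _ _)     = 0
  markerWeight c j (marker c′ j′) = ι c (toℕ c′) * ι j (toℕ j′)

  toℕ-mod : ∀ m n .{{_ : NonZero n}} → toℕ (m mod n) ≡ m % n
  toℕ-mod m n = Fin.toℕ-fromℕ< (m%n<n m n)

  -- The numbers `r * k + c` run through palette `c`, so the sum meets `e` once, at its own rank, or
  -- never.
  ∑-palette : ∀ {c} e (M : ℕ → ℕ) → c < k → ∑ t (λ r → ι (r * k + c) (toℕ e) * M r) ≡ ι c (toℕ (palette e)) * M (rank e)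
  ∑-palette {c} e M c<k with c ≟ toℕ e % k
  ... | yes c≡ = trans (∑-cong t λ r _ → cong (_* M r) (ι-⇔ (quotient r) (remainder r)))
    (trans (∑-ι t M (rank<t e)) (sym (trans (cong (_* M (rank e)) (ι-≡ (trans c≡ (sym (toℕ-mod (toℕ e) k))))) (*-identityˡ (M (rank e))))))
    where
    quotient : ∀ r → r * k + c ≡ toℕ e → r ≡ rank e
    quotient r eq = sym (/-unique r k (≤-trans (m≤m+n (r * k) c) (≤-reflexive eq))
      (subst₂ _<_ eq (+-comm (r * k) k) (+-monoʳ-< (r * k) c<k)))
    remainder : ∀ r → r ≡ rank e → r * k + c ≡ toℕ e
    remainder r refl = trans (cong (r * k +_) c≡) (trans (+-comm (r * k) _) (sym (m≡m%n+[m/n]*n (toℕ e) k)))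
  ... | no c≢ = trans (∑-0 t λ r _ → cong (_* M r) (ι-≢ (c≢ ∘ residue r)))
    (sym (cong (_* M (rank e)) (ι-≢ (λ eq → c≢ (trans eq (toℕ-mod (toℕ e) k))))))
    where
    residue : ∀ r → r * k + c ≡ toℕ e → c ≡ toℕ e % k
    residue r eq = trans (sym (m<n⇒m%n≡m c<k)) (trans (sym ([m+kn]%n≡m%n c r k))
      (cong (_% k) (trans (+-comm c (r * k)) eq)))

  ∑-block : ∀ j q n .{{_ : NonZero n}} → ∑ n (λ s → ι (j * n + s) q) ≡ ι j (q / n)
  ∑-block j q n with j ≟ q / n
  ... | yes refl = trans (∑-cong n λ s _ → trans (ι-⇔ (offset s) (position s)) (sym (*-identityʳ _)))
    (trans (∑-ι n (const 1) (m%n<n q n)) (sym (ι-≡ {q / n} refl)))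
    where
    q≡ : q ≡ q / n * n + q % n
    q≡ = trans (m≡m%n+[m/n]*n q n) (+-comm (q % n) _)
    offset : ∀ s → q / n * n + s ≡ q → s ≡ q % n
    offset s eq = +-cancelˡ-≡ (q / n * n) s (q % n) (trans eq q≡)
    position : ∀ s → s ≡ q % n → q / n * n + s ≡ q
    position s refl = sym q≡
  ... | no j≢ = trans (∑-0 n λ s s<n → ι-≢ λ eq → j≢ (sym (/-unique j n
      (≤-trans (m≤m+n (j * n) s) (≤-reflexive eq)) (subst₂ _<_ eq (+-comm (j * n) n) (+-monoʳ-< (j * n) s<n)))))
    (sym (ι-≢ j≢))

  -- The successor steps over the base letter in front of the marker.
  markerPosition : ℕ → ℕ → ℕ → ℕ
  markerPosition j r s = suc (2 * (j * 2 ^ r + s))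

  -- A marker colour occurs exactly at the odd positions of the `j`-th blocks in its palette; this
  -- resolves a colour count into counts of single vertices.
  markerWeight-colour : ∀ {c j} → c < k → ∀ v →
    markerWeight c j (colour v) ≡ ∑ t (λ r → ∑ (2 ^ r) (λ s → at (r * k + c) (markerPosition j r s) v))
  markerWeight-colour c<k (inj₁ v) = sym (∑-0 t λ r _ → ∑-0 (2 ^ r) λ s _ → refl)
  markerWeight-colour {c} {j} c<k (inj₂ (e , p)) = sym (trans
    (∑-cong t λ r _ → *-∑ (ι (r * k + c) (toℕ e)) (2 ^ r) (λ s → ι (markerPosition j r s) (toℕ p)))
    (trans (∑-palette e (λ r → ∑ (2 ^ r) (λ s → ι (markerPosition j r s) (toℕ p))) c<k) (parity (half (toℕ p)) refl)))
    where
    ℓ = 2 ^ rank e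
    parity : ∀ h → half (toℕ p) ≡ h → ι c (toℕ (palette e)) * ∑ ℓ (λ s → ι (markerPosition j (rank e) s) (toℕ p)) ≡
      markerWeight c j ([ (λ q → base (palette e) (B q)) , (λ q → marker (palette e) ((q /2^ rank e) mod 5)) ]′ h)
    parity (inj₁ q) eq = trans (cong (ι c (toℕ (palette e)) *_) (∑-0 ℓ λ s _ → ι-≢ λ eq′ →
      even≢odd q (j * ℓ + s) (sym (trans eq′ (half-even (toℕ p) eq))))) (*-zeroʳ (ι c (toℕ (palette e))))
    parity (inj₂ q) eq = cong (ι c (toℕ (palette e)) *_) (trans
      (∑-cong ℓ λ s _ → ι-⇔ {markerPosition j (rank e) s} {toℕ p} {j * ℓ + s} {q}
        (λ eq′ → *-cancelˡ-≡ (j * ℓ + s) q 2 (suc-injective (trans eq′ p≡)))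
        (λ eq′ → trans (cong (λ x → suc (2 * x)) eq′) (sym p≡)))
      (trans (∑-block j q ℓ {{2^≢0 (rank e)}}) (cong (ι j) (sym (trans (toℕ-mod (q /2^ rank e) 5) (m<n⇒m%n≡m (m<n*o⇒m/o<n {{2^≢0 (rank e)}} q<5n)))))))
      where
      p≡ : toℕ p ≡ suc (2 * q)
      p≡ = half-odd (toℕ p) eq
      q<5n : q < 5 * ℓ
      q<5n = *-cancelˡ-< 2 q (5 * ℓ) (<-trans (n<1+n (2 * q)) (subst (_< d e) p≡ (Fin.toℕ<n p)))

  -- Counts on a path are 0 or 1, so for a path this says that each `j`-th block lies wholly in `X`
  -- or misses it. The rank of edge number `i` is `i / k`.
  Constant : ℕ → List S → Set
  Constant j X = ∀ i a → start j (i / k) ≤ a → a < start (suc j) (i / k) → count i a X ≡ count i (start j (i / k)) X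

  -- Blocks that contain no end of a path.

  module _ {j x X} (j<5 : j < 5) (linked : Linked Adj (x ∷ X)) (unique : Unique (x ∷ X))
    (x∉ : block x ≢ j) (last∉ : block (last⁺ x X) ≢ j) where

    -- Both ends of the path lie outside the block, so `v` is interior to the path and `neighbour∈`
    -- applies.
    neighbour-in-block : ∀ {v z} → v ∈ x ∷ X → InBlock j v → Adj v z → z ∈ x ∷ X
    neighbour-in-block {inj₂ (e , p)} v∈ inB adj = neighbour∈ x X linked unique v∈ (avoid x∉) (avoid last∉) adj
      where
      avoid : ∀ {w} → block w ≢ j → inj₂ (e , p) ≢ w
      avoid w∉ refl = w∉ (InBlock⇒block (inj₂ (e , p)) inB)

    count-suc : ∀ i a → start j (i / k) ≤ a → suc a < start (suc j) (i / k) →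
      count i a (x ∷ X) ≡ count i (suc a) (x ∷ X)
    count-suc i a lo hi = ≤1-cong (count≤1 i a unique) (count≤1 i (suc a) unique) forwards backwards
      where
      forwards : count i a (x ∷ X) ≢ 0 → count i (suc a) (x ∷ X) ≢ 0
      forwards nz with count≢0⇒∈ i a (x ∷ X) nz
      ... | e , p , v∈ , refl , refl = subst (λ b → count i b (x ∷ X) ≢ 0) p′≡ (∈⇒count≢0
        (neighbour-in-block v∈ (lo , <-trans (n<1+n a) hi) (inj₁ (arc-middle e p p′ (sym p′≡)))))
        where
        p′ : Fin (d e)
        p′ = fromℕ< (<-≤-trans hi (start≤d e j<5))
        p′≡ : toℕ p′ ≡ suc a
        p′≡ = Fin.toℕ-fromℕ< _
      backwards : count i (suc a) (x ∷ X) ≢ 0 → count i a (x ∷ X) ≢ 0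
      backwards nz with count≢0⇒∈ i (suc a) (x ∷ X) nz
      ... | e , p , v∈ , refl , a≡ = subst (λ b → count i b (x ∷ X) ≢ 0) p′≡ (∈⇒count≢0
        (neighbour-in-block v∈ (subst (start j (rank e) ≤_) a≡ (m≤n⇒m≤1+n lo) , subst (_< start (suc j) (rank e)) a≡ hi)
          (inj₂ (arc-middle e p′ p (trans (cong suc p′≡) a≡)))))
        where
        p′ : Fin (d e)
        p′ = fromℕ< (<-≤-trans (<-trans (n<1+n a) hi) (start≤d e j<5))
        p′≡ : toℕ p′ ≡ a
        p′≡ = Fin.toℕ-fromℕ< _

    constant : Constant j (x ∷ X)
    constant i a lo hi = subst (λ b → count i b (x ∷ X) ≡ count i s (x ∷ X)) (m+[n∸m]≡n lo)
      (go (a ∸ s) (subst (_< start (suc j) (i / k)) (sym (m+[n∸m]≡n lo)) hi))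
      where
      s = start j (i / k)
      go : ∀ u → s + u < start (suc j) (i / k) → count i (s + u) (x ∷ X) ≡ count i s (x ∷ X)
      go zero    _  = cong (λ b → count i b (x ∷ X)) (+-identityʳ s)
      go (suc u) hi = trans (cong (λ b → count i b (x ∷ X)) (+-suc s u)) (trans
        (sym (count-suc i (s + u) (m≤m+n s u) hi′)) (go u (<-trans (n<1+n (s + u)) hi′)))
        where
        hi′ : suc (s + u) < start (suc j) (i / k)
        hi′ = subst (_< start (suc j) (i / k)) (+-suc s u) hi

  -- Presence of a whole block, once `X` is `Constant j`, read off at the first vertex of the block.
  bit : ℕ → ℕ → List S → ℕ → ℕ
  bit j c X r = count (r * k + c) (start j r) X

  -- A block that lies in `X` contributes all of its `2 ^ r` markers, which gives a sum of powers of
  -- two.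
  wt-marker : ∀ j c X → c < k → Constant j X →
    wt (markerWeight c j ∘ colour) X ≡ ∑ t (λ r → 2 ^ r * bit j c X r)
  wt-marker j c X c<k con = begin
    wt (markerWeight c j ∘ colour) X
      ≡⟨ wt-cong (markerWeight-colour c<k) X ⟩
    wt (λ v → ∑ t (λ r → ∑ (2 ^ r) (λ s → at (r * k + c) (markerPosition j r s) v))) X
      ≡⟨ wt-∑ t (λ r v → ∑ (2 ^ r) (λ s → at (r * k + c) (markerPosition j r s) v)) X ⟩
    ∑ t (λ r → wt (λ v → ∑ (2 ^ r) (λ s → at (r * k + c) (markerPosition j r s) v)) X)
      ≡⟨ ∑-cong t (λ r _ → trans (wt-∑ (2 ^ r) (λ s → at (r * k + c) (markerPosition j r s)) X)
           (trans (∑-cong (2 ^ r) (λ s → in-block r s)) (∑-const (bit j c X r) (2 ^ r)))) ⟩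
    ∑ t (λ r → 2 ^ r * bit j c X r) ∎
    where
    open ≡-Reasoning
    quotient : ∀ r → (r * k + c) / k ≡ r
    quotient r = /-unique r k (m≤m+n (r * k) c) (subst (r * k + c <_) (+-comm (r * k) k) (+-monoʳ-< (r * k) c<k))
    in-block : ∀ r s → s < 2 ^ r → count (r * k + c) (markerPosition j r s) X ≡ bit j c X r
    in-block r s s< = subst (λ q → start j q ≤ a → a < start (suc j) q → count (r * k + c) a X ≡ count (r * k + c) (start j q) X)
      (quotient r) (con (r * k + c) a) (m≤n⇒m≤1+n (*-monoʳ-≤ 2 (m≤m+n (j * 2 ^ r) s))) hi
      where
      a = markerPosition j r s
      hi : a < start (suc j) r
      hi = ≤-trans (≤-reflexive (sym (*-suc 2 (j * 2 ^ r + s)))) (*-monoʳ-≤ 2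
        (subst (suc (j * 2 ^ r + s) ≤_) (+-comm (j * 2 ^ r) (2 ^ r)) (subst (_≤ j * 2 ^ r + 2 ^ r) (+-suc (j * 2 ^ r) s) (+-monoʳ-≤ (j * 2 ^ r) s<))))

  -- The halves share no vertex, so their bits are disjoint, while the balance equates the two
  -- binary sums; `disjoint-binary` makes every bit zero.
  no-block : ∀ j L R → Unique (L ++ R) → Constant j L → Constant j R →
    (∀ f → wt (f ∘ colour) L ≡ wt (f ∘ colour) R) → ∀ {v} → v ∈ L ++ R → ¬ InBlock j v
  no-block j L R unique conL conR bal {inj₂ (e , p)} v∈ (lo , hi) =
    [ (λ v∈L → ∈⇒count≢0 v∈L (trans (conL (toℕ e) (toℕ p) lo hi) (trans (at-start L) (proj₁ bits))))
    , (λ v∈R → ∈⇒count≢0 v∈R (trans (conR (toℕ e) (toℕ p) lo hi) (trans (at-start R) (proj₂ bits))))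
    ]′ (∈-++⁻ L v∈)
    where
    c = toℕ e % k
    c<k = m%n<n (toℕ e) k
    at-start : ∀ X → count (toℕ e) (start j (rank e)) X ≡ bit j c X (rank e)
    at-start X = cong (λ i → count i (start j (rank e)) X) (trans (m≡m%n+[m/n]*n (toℕ e) k) (+-comm c _))
    bits : bit j c L (rank e) ≡ 0 × bit j c R (rank e) ≡ 0
    bits = disjoint-binary t {bit j c L} {bit j c R}
      (λ r → subst (_≤ 1) (wt-++ (at (r * k + c) (start j r)) L R) (count≤1 (r * k + c) (start j r) unique))
      (trans (sym (wt-marker j c L c<k conL)) (trans (bal (markerWeight c j)) (wt-marker j c R c<k conR)))
      (rank<t e)

  -- Subdivided stars around the original vertices.

  centre : ℕ → S → Fin (n G)
  centre j (inj₁ v)       = v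
  centre j (inj₂ (e , p)) = if does (toℕ p <? start j (rank e)) then src G e else tgt G e

  centre-src : ∀ j e p → toℕ p < start j (rank e) → centre j (inj₂ (e , p)) ≡ src G e
  centre-src j e p lt = cong (if_then src G e else tgt G e) (dec-true (toℕ p <? start j (rank e)) lt)

  centre-tgt : ∀ j e p → ¬ toℕ p < start j (rank e) → centre j (inj₂ (e , p)) ≡ tgt G e
  centre-tgt j e p ≮ = cong (if_then src G e else tgt G e) (dec-false (toℕ p <? start j (rank e)) ≮)

  start<start-suc : ∀ j r → start j r < start (suc j) r
  start<start-suc j r = subst (start j r <_) (sym (start-suc j r)) (m<m+n (start j r) (*-mono-< {0} {2} {0} (s≤s z≤n) (m^n>0 2 r)))

  -- Outside the j-th blocks the subdivision falls apart into subdivided stars,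
  -- and  centre j  names the star of a vertex.
  arc-centre : ∀ {j u v} → j < 5 → SubdivArc G d u v → ¬ InBlock j u → ¬ InBlock j v → centre j u ≡ centre j v
  arc-centre j<5 (arc-direct e d≡0) _ _ = contradiction d≡0 (d≢0 e)
    where
    d≢0 : ∀ e → d e ≢ 0
    d≢0 e d≡0 = contradiction (≤-trans (start<start-suc 0 (rank e)) (≤-trans (start≤d {0} e (s≤s z≤n)) (≤-reflexive d≡0))) λ ()
  arc-centre {j} j<5 (arc-first e p p≡0) _ v∉ with toℕ p <? start j (rank e)
  ... | yes lt = sym (centre-src j e p lt)
  -- This arises only for `j = 0`, where the first division vertex already belongs to the block.
  ... | no ≮   = contradiction (≮⇒≥ ≮ , subst (_< start (suc j) (rank e)) (sym p≡0)
    (≤-<-trans z≤n (start<start-suc j (rank e)))) v∉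
  arc-centre {j} j<5 (arc-middle e p p′ p′≡) u∉ v∉ with toℕ p <? start j (rank e) | toℕ p′ <? start j (rank e)
  ... | yes lt | yes lt′ = trans (centre-src j e p lt) (sym (centre-src j e p′ lt′))
  ... | no ≮   | no ≮′   = trans (centre-tgt j e p ≮) (sym (centre-tgt j e p′ ≮′))
  ... | no ≮   | yes lt′ = contradiction (≤-<-trans (m≤n⇒m≤1+n ≤-refl) (subst (_< start j (rank e)) (sym p′≡) lt′)) ≮
  -- Crossing the start of the block means entering it.
  ... | yes lt | no ≮′   = contradiction (≮⇒≥ ≮′ , ≤-<-trans (subst (_≤ start j (rank e)) p′≡ lt) (start<start-suc j (rank e))) v∉
  arc-centre {j} j<5 (arc-last e p p≡) u∉ _ with toℕ p <? start j (rank e)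
  ... | no ≮   = centre-tgt j e p ≮
  ... | yes lt = contradiction (<-≤-trans (start<start-suc j (rank e)) (≤-trans (start≤d e j<5)
    (≤-trans (≤-reflexive (sym p≡)) lt))) (<-irrefl refl)

  path-centre : ∀ {j x X} → j < 5 → Linked Adj (x ∷ X) → (∀ {v} → v ∈ x ∷ X → ¬ InBlock j v) →
    ∀ {v} → v ∈ x ∷ X → centre j v ≡ centre j x
  path-centre j<5 _       _      (here refl) = refl
  path-centre j<5 (r ∷ l) avoids (there v∈)  = trans (path-centre j<5 l (avoids ∘ there) v∈)
    ([ (λ a → sym (arc-centre j<5 a x∉ y∉)) , (λ a → arc-centre j<5 a y∉ x∉) ]′ r)
    where
    x∉ = avoids (here refl)
    y∉ = avoids (there (here refl))

  vertexWeight : Colour k → ℕ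
  vertexWeight vertex       = 1
  vertexWeight (base _ _)   = 0
  vertexWeight (marker _ _) = 0

  vertexWeight≢0 : ∀ v → vertexWeight (colour v) ≢ 0 → ∃ λ u → v ≡ inj₁ u
  vertexWeight≢0 (inj₁ u) _ = u , refl
  vertexWeight≢0 (inj₂ (e , p)) nz with half (toℕ p)
  ... | inj₁ _ = contradiction refl nz
  ... | inj₂ _ = contradiction refl nz

  -- By balance, an original vertex in one half forces one in the other.
  no-vertex : ∀ {X Y} → (∀ {u v} → inj₁ u ∈ X → inj₁ v ∈ Y → ⊥) →
    wt (vertexWeight ∘ colour) X ≡ wt (vertexWeight ∘ colour) Y → ∀ {u} → inj₁ u ∉ X
  no-vertex {X} {Y} disjoint bal u∈ with wt≢0⇒∃ (vertexWeight ∘ colour) Y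
    (λ z → contradiction (subst (1 ≤_) (trans bal z) (≤-wt (vertexWeight ∘ colour) u∈)) λ ())
  ... | v , v∈ , nz with vertexWeight≢0 v nz
  ...   | _ , refl = disjoint u∈ v∈

  -- Anagrams inside one edge.

  baseWeight : (Letter → ℕ) → Colour k → ℕ
  baseWeight f vertex       = 0
  baseWeight f (base _ b)   = f b
  baseWeight f (marker _ _) = 0

  ∑-edgeColour : ∀ f e a → ∑ a (baseWeight f ∘ edgeColour e) ≡ ∑ ⌈ a /2⌉ (f ∘ B)
  ∑-edgeColour f e a = trans (∑-cong a λ i _ → pointwise (half i)) (∑-half a (f ∘ B))
    where
    pointwise : ∀ h → baseWeight f ([ (λ q → base (palette e) (B q)) , (λ q → marker (palette e) ((q /2^ rank e) mod 5)) ]′ h) ≡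
      [ f ∘ B , const 0 ]′ h
    pointwise (inj₁ q) = refl
    pointwise (inj₂ q) = refl

  -- Weights that ignore markers turn the three cuts of the edge into cuts of `B` at half their
  -- positions, rounded up. These coincide, whereas for positive `ℓ` the outer two are at least two
  -- positions apart.
  edge-anagramFree : ∀ e x ℓ → x + ℓ + ℓ ≤ d e →
    (∀ f → ∑ x (f ∘ edgeColour e) + ∑ (x + ℓ + ℓ) (f ∘ edgeColour e) ≡ ∑ (x + ℓ) (f ∘ edgeColour e) + ∑ (x + ℓ) (f ∘ edgeColour e)) →
    ℓ ≡ 0
  edge-anagramFree e x zero    _     _   = refl
  edge-anagramFree e x (suc ℓ) bound bal = contradiction (trans x≡z z≡) (<⇒≢ (s≤s (⌈n/2⌉-mono (m≤m+n x (ℓ + ℓ)))))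
    where
    y = x + suc ℓ
    z = x + suc ℓ + suc ℓ
    letters : ∀ f → ∑ ⌈ x /2⌉ (f ∘ B) + ∑ ⌈ z /2⌉ (f ∘ B) ≡ ∑ ⌈ y /2⌉ (f ∘ B) + ∑ ⌈ y /2⌉ (f ∘ B)
    letters f = trans (sym (cong₂ _+_ (∑-edgeColour f e x) (∑-edgeColour f e z)))
      (trans (bal (baseWeight f)) (cong₂ _+_ (∑-edgeColour f e y) (∑-edgeColour f e y)))
    z≤ : ⌈ z /2⌉ ≤ 5 * 2 ^ t
    z≤ = ≤-trans (⌈n/2⌉-mono bound) (≤-trans (≤-reflexive (⌈2n/2⌉ (5 * 2 ^ rank e)))
      (*-monoʳ-≤ 5 (^-monoʳ-≤ 2 (<⇒≤ (rank<t e)))))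
      where
      ⌈2n/2⌉ : ∀ a → ⌈ 2 * a /2⌉ ≡ a
      ⌈2n/2⌉ a = trans (cong (λ b → ⌈ a + b /2⌉) (+-identityʳ a)) (sym (n≡⌈n+n/2⌉ a))
    y≤ : ⌈ y /2⌉ ≤ 5 * 2 ^ t
    y≤ = ≤-trans (⌈n/2⌉-mono (m≤m+n y (suc ℓ))) z≤
    x≤ : ⌈ x /2⌉ ≤ 5 * 2 ^ t
    x≤ = ≤-trans (⌈n/2⌉-mono (m≤m+n x (suc ℓ))) y≤
    x≡y : ⌈ x /2⌉ ≡ ⌈ y /2⌉
    x≡y = proj₂ (abelianSquareFree (5 * 2 ^ t)) x≤ y≤ z≤ letters
    z≡y : ⌈ z /2⌉ ≡ ⌈ y /2⌉
    -- The balance is symmetric in `x` and `z`. The equation `x≡y` alone is no contradiction, as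
    -- rounding can absorb a single step.
    z≡y = proj₂ (abelianSquareFree (5 * 2 ^ t)) z≤ y≤ x≤ (λ f → trans (+-comm (∑ ⌈ z /2⌉ (f ∘ B)) _) (letters f))
    x≡z : ⌈ x /2⌉ ≡ ⌈ z /2⌉
    x≡z = trans x≡y (sym z≡y)
    z≡ : ⌈ z /2⌉ ≡ suc ⌈ x + (ℓ + ℓ) /2⌉
    z≡ = cong ⌈_/2⌉ (lemma x ℓ)
      where
      lemma : ∀ x ℓ → x + suc ℓ + suc ℓ ≡ suc (suc (x + (ℓ + ℓ)))
      lemma = solve-∀

  -- Excluding anagrams on arbitrary paths.

  anagramFree : AnagramFree (subdivision G d) (encode ∘ colour)
  anagramFree vs path anagram with anagram-halves colour vs anagram
  anagramFree _ (unique , linked) _ | [] , R , refl , L≢[] , _ = L≢[] refl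
  anagramFree _ (unique , linked) _ | x ∷ L , [] , refl , _ , bal = contradiction (bal (const 1)) λ ()
  anagramFree _ (unique , linked) _ | x ∷ L , y ∷ R , refl , L≢[] , bal
    with fresh (block x ∷ block (last⁺ x L) ∷ block y ∷ block (last⁺ y R) ∷ []) ≤-refl
       | Unique-++⁻ (x ∷ L) unique | Linked-++⁻ (x ∷ L) linked
  ... | j , j∉ | uL , uR , disjoint | lL , lR =
    contradiction (edge-anagramFree e a (length (x ∷ L)) (proj₁ (proj₂ sums))
      (λ f → proj₂ (proj₂ sums) (f ∘ edgeColour e) (f ∘ colour) (λ _ → refl) (bal f))) λ ()
    where
    avoids : ∀ {v} → v ∈ x ∷ L ++ y ∷ R → ¬ InBlock (toℕ j) v
    avoids = no-block (toℕ j) (x ∷ L) (y ∷ R) unique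
      (constant (Fin.toℕ<n j) lL uL (λ eq → j∉ (here (sym eq))) (λ eq → j∉ (there (here (sym eq)))))
      (constant (Fin.toℕ<n j) lR uR (λ eq → j∉ (there (there (here (sym eq))))) (λ eq → j∉ (there (there (there (here (sym eq)))))))
      bal
    one-vertex : ∀ {u v} → inj₁ u ∈ x ∷ L → inj₁ v ∈ y ∷ R → ⊥
    -- The path avoids all `j`-th blocks, so `centre` is constant on it; two original vertices would
    -- both equal this centre, but the halves are disjoint.
    one-vertex u∈ v∈ with trans (path-centre (Fin.toℕ<n j) linked avoids (∈-++⁺ˡ u∈))
      (sym (path-centre (Fin.toℕ<n j) linked avoids (∈-++⁺ʳ (x ∷ L) v∈)))
    ... | refl = disjoint u∈ v∈
    no-vertices : ∀ u → inj₁ u ∉ x ∷ L ++ y ∷ R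
    no-vertices u u∈ = [ no-vertex one-vertex (bal vertexWeight) , no-vertex (λ v∈ u∈ → one-vertex u∈ v∈) (sym (bal vertexWeight)) ]′
      (∈-++⁻ (x ∷ L) u∈)
    run = monotone linked unique no-vertices λ ()
    e = proj₁ run
    lengths : length (x ∷ L) ≡ length (y ∷ R)
    lengths = trans (sym (wt-1 (x ∷ L))) (trans (bal (const 1)) (wt-1 (y ∷ R)))
    sums = run-sums (x ∷ L) (y ∷ R) (proj₂ run) L≢[] lengths
    a = proj₁ sums

theorem16 : (G : SimpleGraph) (k : ℕ) → .{{_ : NonZero k}} →
    Σ (Edge G → ℕ) (λ d →
    (∀ i → d i ≤ 3 * 4 ^ ⌈ numEdges G / k ⌉) × φ≤ (subdivision G d) (2 + 12 * k))
theorem16 G k = d , d≤ , encode ∘ colour , anagramFree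
  where open Construction G k
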